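{- The satisfiability problem for $\mathrm{TeamLTL}(\subseteq,\lor_{\mathsf B})$ is $\Sigma^0_1$-hard, and the satisfiability problem for $\mathrm{TeamLTL}(\subseteq,\lor_{\mathsf B},\mathsf A)$ is $\Sigma^1_1$-hard.
   Context: LTL formulae over a set $\mathrm{AP}$ of atomic propositions are given in negation normal form: $\varphi ::= p \mid \neg p \mid \varphi\lor\varphi \mid \varphi\land\varphi \mid \mathsf X\varphi \mid \varphi\,\mathsf U\,\varphi \mid \varphi\,\mathsf W\,\varphi$ with $p\in\mathrm{AP}$; $\bot:=p\land\neg p$, $\top:=p\lor\neg p$, $\mathsf F\varphi:=\top\,\mathsf U\,\varphi$, $\mathsf G\varphi:=\varphi\,\mathsf W\,\bot$. A trace is an element of $(2^{\mathrm{AP}})^\omega$, and $t[i]$ is its $i$-th letter. For an LTL formula $\varphi$, $\llbracket\varphi\rrbracket_{(t,i)}\in\{0,1\}$ is its usual LTL truth value on trace $t$ at position $i$. A team is a pair $(T,i)$ with $T\subseteq(2^{\mathrm{AP}})^\omega$ and $i\in\mathbb N$. TeamLTL is LTL with the following (synchronous) team semantics: - $(T,i)\models p$ iff $p\in t[i]$ for all $t\in T$; $(T,i)\models\neg p$ iff $p\notin t[i]$ for all $t\in T$; - $(T,i)\models\varphi\land\psi$ iff $(T,i)\models\varphi$ and $(T,i)\models\psi$; - $(T,i)\models\varphi\lor\psi$ iff there are $T_1,T_2$ with $T_1\cup T_2=T$, $(T_1,i)\models\varphi$ and $(T_2,i)\models\psi$; - $(T,i)\models\mathsf X\varphi$ iff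 $(T,i+1)\models\varphi$; - $(T,i)\models\varphi\,\mathsf U\,\psi$ iff there is $k\ge i$ with $(T,k)\models\psi$ and $(T,m)\models\varphi$ for all $i\le m<k$; - $(T,i)\models\varphi\,\mathsf W\,\psi$ iff for all $k\ge i$: $(T,k)\models\varphi$ or there is $m$ with $i\le m\le k$ and $(T,m)\models\psi$. $\mathrm{TeamLTL}(\subseteq,\lor_{\mathsf B})$ additionally allows inclusion atoms and Boolean disjunction, and $\mathrm{TeamLTL}(\subseteq,\lor_{\mathsf B},\mathsf A)$ further allows the universal subteam quantifier $\mathsf A$: - inclusion atoms $\varphi_1,\dots,\varphi_n\subseteq\psi_1,\dots,\psi_n$ with LTL formulae $\varphi_j,\psi_j$: $(T,i)$ satisfies it iff for every $t\in T$ there is $t'\in T$ with $\llbracket\varphi_j\rrbracket_{(t,i)}=\llbracket\psi_j\rrbracket_{(t',i)}$ for all $1\le j\le n$; - $(T,i)\models\varphi\lor_{\mathsf B}\psi$ iff $(T,i)\models\varphi$ or $(T,i)\models\psi$; - $(T,i)\models\mathsf A\varphi$ iff $(S,i)\models\varphi$ for all $S\subseteq T$. A formula $\varphi$ is satisfiable if there is a non-empty set $T$ of traces with $(T,0)\models\varphi$. The satisfiability problem of a logic: given a formula of the logic, decide whether it is satisfiable. Hardness is with respect to computable many-one reductions. -}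

module Defs where

open import Data.Bool.Base using (Bool; true; false; if_then_else_)
open import Data.Fin.Base using (Fin)
open import Data.Nat.Base using (ℕ; zero; suc; _+_; _*_; _≤_; _<_)
open import Data.Product.Base using (Σ-syntax; ∃-syntax; _×_; _,_)
open import Data.Sum.Base using (_⊎_)
open import Data.Vec.Base using (Vec; []; _∷_; lookup)
open import Function.Bundles using (_⇔_)
open import Level using (Level; Lift; 0ℓ) renaming (suc to lsuc; _⊔_ to _⊔ˡ_)
open import Relation.Binary.PropositionalEquality using (_≡_)
open import Relation.Nullary.Negation using (¬_)
open import Relation.Unary using (Pred; _∈_; _⊆_; _∪_; _≐_; Satisfiable)

data Rec : ℕ → Set where
  zer  : Rec 0
  succ : Rec 1
  proj : ∀ {n} → Fin n → Rec n
  comp : ∀ {m n} → Rec m → Vec (Rec n) m → Rec n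
  prim : ∀ {n} → Rec n → Rec (2 + n) → Rec (1 + n)
  mu   : ∀ {n} → Rec (1 + n) → Rec n

infix 4 _[_]⇓_

-- The graph of a partial recursive function: prim recurses on, and mu
-- searches over, the first argument.
data _[_]⇓_ : ∀ {n} → Rec n → Vec ℕ n → ℕ → Set where
  zer⇓  : zer [ [] ]⇓ 0
  succ⇓ : ∀ {x} → succ [ x ∷ [] ]⇓ suc x
  proj⇓ : ∀ {n} {i : Fin n} {xs} → proj i [ xs ]⇓ lookup xs i
  comp⇓ : ∀ {m n} {f : Rec m} {gs : Vec (Rec n) m} {xs ys z} →
          (∀ i → lookup gs i [ xs ]⇓ lookup ys i) →
          f [ ys ]⇓ z →
          comp f gs [ xs ]⇓ z
  prim-zero⇓ : ∀ {n} {g : Rec n} {h xs z} →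
               g [ xs ]⇓ z →
               prim g h [ 0 ∷ xs ]⇓ z
  prim-suc⇓  : ∀ {n} {g : Rec n} {h x xs y z} →
               prim g h [ x ∷ xs ]⇓ y →
               h [ x ∷ y ∷ xs ]⇓ z →
               prim g h [ suc x ∷ xs ]⇓ z
  mu⇓ : ∀ {n} {f : Rec (1 + n)} {xs y} →
        f [ y ∷ xs ]⇓ 0 →
        (∀ x → x < y → ∃[ z ] f [ x ∷ xs ]⇓ suc z) →
        mu f [ xs ]⇓ y

Computable : ∀ {n} → (Vec ℕ n → ℕ) → Set
Computable {n} f = Σ[ c ∈ Rec n ] (∀ xs → c [ xs ]⇓ f xs)

Computable₁ : (ℕ → ℕ) → Set
Computable₁ f = Computable {1} λ { (x ∷ []) → f x }

ComputableRel₂ : (ℕ → ℕ → Bool) → Set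
ComputableRel₂ R =
  Computable {2} λ { (x ∷ y ∷ []) → if R x y then 1 else 0 }

data Term (n : ℕ) : Set where
  var       : Fin n → Term n
  `zero     : Term n
  `suc      : Term n → Term n
  _`+_ _`*_ : Term n → Term n → Term n

-- k free set variables and n free number variables (de Bruijn indices);
-- quantifiers bind number variables only, so every formula is arithmetical.
data Arith (k n : ℕ) : Set where
  _`≡_      : Term n → Term n → Arith k n
  _`∈_      : Term n → Fin k → Arith k n
  `¬_       : Arith k n → Arith k n
  _`∧_ _`∨_ : Arith k n → Arith k n → Arith k n
  `∀_ `∃_   : Arith k (suc n) → Arith k n

⟦_⟧ᵗ : ∀ {n} → Term n → Vec ℕ n → ℕ
⟦ var x   ⟧ᵗ ρ = lookup ρ x
⟦ `zero   ⟧ᵗ ρ = 0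
⟦ `suc t  ⟧ᵗ ρ = suc (⟦ t ⟧ᵗ ρ)
⟦ t `+ u  ⟧ᵗ ρ = ⟦ t ⟧ᵗ ρ + ⟦ u ⟧ᵗ ρ
⟦ t `* u  ⟧ᵗ ρ = ⟦ t ⟧ᵗ ρ * ⟦ u ⟧ᵗ ρ

⟦_⟧ᵃ : ∀ {k n} → Arith k n → (Fin k → ℕ → Bool) → Vec ℕ n → Set
⟦ t `≡ u ⟧ᵃ X ρ = ⟦ t ⟧ᵗ ρ ≡ ⟦ u ⟧ᵗ ρ
⟦ t `∈ x ⟧ᵃ X ρ = X x (⟦ t ⟧ᵗ ρ) ≡ true
⟦ `¬ φ   ⟧ᵃ X ρ = ¬ ⟦ φ ⟧ᵃ X ρ
⟦ φ `∧ ψ ⟧ᵃ X ρ = ⟦ φ ⟧ᵃ X ρ × ⟦ ψ ⟧ᵃ X ρ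
⟦ φ `∨ ψ ⟧ᵃ X ρ = ⟦ φ ⟧ᵃ X ρ ⊎ ⟦ ψ ⟧ᵃ X ρ
⟦ `∀ φ   ⟧ᵃ X ρ = ∀ a → ⟦ φ ⟧ᵃ X (a ∷ ρ)
⟦ `∃ φ   ⟧ᵃ X ρ = ∃[ a ] ⟦ φ ⟧ᵃ X (a ∷ ρ)

Σ⁰₁ : Pred (Pred ℕ 0ℓ) 0ℓ
Σ⁰₁ A = Σ[ R ∈ (ℕ → ℕ → Bool) ]
  ComputableRel₂ R × (∀ n → A n ⇔ (∃[ m ] R n m ≡ true))

Σ¹₁ : Pred (Pred ℕ 0ℓ) 0ℓ
Σ¹₁ A = ∃[ k ] Σ[ ψ ∈ Arith k 1 ]
  (∀ n → A n ⇔ (Σ[ X ∈ (Fin k → ℕ → Bool) ] ⟦ ψ ⟧ᵃ X (n ∷ [])))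

-- A decision problem is a predicate P on instances, presented to a machine
-- through a Gödel numbering of the instances.
module _ {ℓ : Level} {Instance : Set} (code : Instance → ℕ) where

  infix 4 _≤ₘ_

  _≤ₘ_ : Pred ℕ 0ℓ → Pred Instance ℓ → Set ℓ
  A ≤ₘ P = Σ[ f ∈ (ℕ → Instance) ]
    Computable₁ (λ n → code (f n)) × (∀ n → A n ⇔ P (f n))

  Hard : Pred (Pred ℕ 0ℓ) 0ℓ → Pred Instance ℓ → Set (lsuc 0ℓ ⊔ˡ ℓ)
  Hard Γ P = ∀ A → Γ A → A ≤ₘ P

-- Formulas mention finitely many propositions but their number is not
-- bounded in advance, so AP is countably infinite.
AP : Set
AP = ℕ

-- t i p tells whether p belongs to the letter t[i] ∈ 2^AP.
Trace : Set
Trace = ℕ → AP → Bool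

infix  9 X_ 𝖠_
infixr 8 _U_ _W_
infixr 7 _∧_
infixr 6 _∨_ _∨ᴮ_

data LTL : Set where
  atom natom    : AP → LTL
  _∨_ _∧_ _U_ _W_ : LTL → LTL → LTL
  X_            : LTL → LTL

-- The truth value of an LTL formula is a proposition, so that equality of
-- two truth values is _⇔_.
⟦_⟧ : LTL → Trace → ℕ → Set
⟦ atom p  ⟧ t i = t i p ≡ true
⟦ natom p ⟧ t i = t i p ≡ false
⟦ φ ∨ ψ   ⟧ t i = ⟦ φ ⟧ t i ⊎ ⟦ ψ ⟧ t i
⟦ φ ∧ ψ   ⟧ t i = ⟦ φ ⟧ t i × ⟦ ψ ⟧ t i
⟦ X φ     ⟧ t i = ⟦ φ ⟧ t (suc i)
⟦ φ U ψ   ⟧ t i = ∃[ k ] i ≤ k × ⟦ ψ ⟧ t k ×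
                    (∀ m → i ≤ m → m < k → ⟦ φ ⟧ t m)
⟦ φ W ψ   ⟧ t i = ∀ k → i ≤ k →
                    ⟦ φ ⟧ t k ⊎ (∃[ m ] i ≤ m × m ≤ k × ⟦ ψ ⟧ t m)

data Logic : Set where
  ⊆,∨ᴮ ⊆,∨ᴮ,𝖠 : Logic

data TeamLTL : Logic → Set where
  atom natom           : ∀ {L} → AP → TeamLTL L
  _∨_ _∧_ _U_ _W_ _∨ᴮ_ : ∀ {L} → TeamLTL L → TeamLTL L → TeamLTL L
  X_                   : ∀ {L} → TeamLTL L → TeamLTL L
  -- φ₁,…,φₙ ⊆ ψ₁,…,ψₙ with n ≥ 1
  incl                 : ∀ {L n} → Vec LTL (suc n) → Vec LTL (suc n) → TeamLTL L
  𝖠_                   : TeamLTL ⊆,∨ᴮ,𝖠 → TeamLTL ⊆,∨ᴮ,𝖠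

infix 4 _,_⊨_

_,_⊨_ : ∀ {L} → Pred Trace 0ℓ → ℕ → TeamLTL L → Set (lsuc 0ℓ)
T , i ⊨ atom p     = Lift _ (∀ {t} → t ∈ T → t i p ≡ true)
T , i ⊨ natom p    = Lift _ (∀ {t} → t ∈ T → t i p ≡ false)
T , i ⊨ (φ ∧ ψ)    = (T , i ⊨ φ) × (T , i ⊨ ψ)
T , i ⊨ (φ ∨ ψ)    = Σ[ T₁ ∈ Pred Trace 0ℓ ] Σ[ T₂ ∈ Pred Trace 0ℓ ]
                       (T₁ ∪ T₂ ≐ T) × (T₁ , i ⊨ φ) × (T₂ , i ⊨ ψ)
T , i ⊨ (X φ)      = T , suc i ⊨ φ
T , i ⊨ (φ U ψ)    = ∃[ k ] i ≤ k × (T , k ⊨ ψ) ×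
                       (∀ m → i ≤ m → m < k → T , m ⊨ φ)
T , i ⊨ (φ W ψ)    = ∀ k → i ≤ k →
                       (T , k ⊨ φ) ⊎ (∃[ m ] i ≤ m × m ≤ k × (T , m ⊨ ψ))
T , i ⊨ incl φs ψs = Lift _ (∀ {t} → t ∈ T → Σ[ t′ ∈ Trace ] t′ ∈ T ×
                       (∀ j → ⟦ lookup φs j ⟧ t i ⇔ ⟦ lookup ψs j ⟧ t′ i))
T , i ⊨ (φ ∨ᴮ ψ)   = (T , i ⊨ φ) ⊎ (T , i ⊨ ψ)
T , i ⊨ (𝖠 φ)      = ∀ (S : Pred Trace 0ℓ) → S ⊆ T → S , i ⊨ φ

SAT : ∀ L → Pred (TeamLTL L) (lsuc 0ℓ)
SAT L φ = Σ[ T ∈ Pred Trace 0ℓ ] Satisfiable T × (T , 0 ⊨ φ)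

-- Injective, because (a + b)² ≤ ⟨ a , b ⟩ < (a + b + 1)².
⟨_,_⟩ : ℕ → ℕ → ℕ
⟨ a , b ⟩ = (a + b) * (a + b) + a

⌜_⌝ᴸ : LTL → ℕ
⌜ atom p  ⌝ᴸ = ⟨ 0 , p ⟩
⌜ natom p ⌝ᴸ = ⟨ 1 , p ⟩
⌜ φ ∨ ψ   ⌝ᴸ = ⟨ 2 , ⟨ ⌜ φ ⌝ᴸ , ⌜ ψ ⌝ᴸ ⟩ ⟩
⌜ φ ∧ ψ   ⌝ᴸ = ⟨ 3 , ⟨ ⌜ φ ⌝ᴸ , ⌜ ψ ⌝ᴸ ⟩ ⟩
⌜ X φ     ⌝ᴸ = ⟨ 4 , ⌜ φ ⌝ᴸ ⟩
⌜ φ U ψ   ⌝ᴸ = ⟨ 5 , ⟨ ⌜ φ ⌝ᴸ , ⌜ ψ ⌝ᴸ ⟩ ⟩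
⌜ φ W ψ   ⌝ᴸ = ⟨ 6 , ⟨ ⌜ φ ⌝ᴸ , ⌜ ψ ⌝ᴸ ⟩ ⟩

⌜_⌝ⱽ : ∀ {n} → Vec LTL n → ℕ
⌜ []     ⌝ⱽ = 0
⌜ φ ∷ φs ⌝ⱽ = suc ⟨ ⌜ φ ⌝ᴸ , ⌜ φs ⌝ⱽ ⟩

⌜_⌝ : ∀ {L} → TeamLTL L → ℕ
⌜ atom p     ⌝ = ⟨ 0 , p ⟩
⌜ natom p    ⌝ = ⟨ 1 , p ⟩
⌜ φ ∨ ψ      ⌝ = ⟨ 2 , ⟨ ⌜ φ ⌝ , ⌜ ψ ⌝ ⟩ ⟩
⌜ φ ∧ ψ      ⌝ = ⟨ 3 , ⟨ ⌜ φ ⌝ , ⌜ ψ ⌝ ⟩ ⟩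
⌜ X φ        ⌝ = ⟨ 4 , ⌜ φ ⌝ ⟩
⌜ φ U ψ      ⌝ = ⟨ 5 , ⟨ ⌜ φ ⌝ , ⌜ ψ ⌝ ⟩ ⟩
⌜ φ W ψ      ⌝ = ⟨ 6 , ⟨ ⌜ φ ⌝ , ⌜ ψ ⌝ ⟩ ⟩
⌜ φ ∨ᴮ ψ     ⌝ = ⟨ 7 , ⟨ ⌜ φ ⌝ , ⌜ ψ ⌝ ⟩ ⟩
⌜ incl φs ψs ⌝ = ⟨ 8 , ⟨ ⌜ φs ⌝ⱽ , ⌜ ψs ⌝ⱽ ⟩ ⟩
⌜ 𝖠 φ        ⌝ = ⟨ 9 , ⌜ φ ⌝ ⟩

-- Both parts use the same reduction, from truth of a first-order sentence over
-- ℕ with < and with two ternary relations seq and mem that are quantified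
-- existentially. Positions of time stand for numbers: every position carries
-- three labels, and a trace is the characteristic sequence of the positions
-- labelled by one number v. A universal quantifier becomes G and an existential
-- one F, followed by a splitting that keeps, among the traces reserved for that
-- quantifier, only those whose number labels the current position. Every triple
-- of labels recurs, so an atom can be evaluated at any later position where the
-- labels are the numbers of the chosen traces. Each trace also marks the
-- position equal to its number, which lets G and X fix < to be the true order
-- and leaves no room for nonstandard numbers.
--
-- With seq a functional relation serving as a sequence coding, graphs of partial
-- recursive functions are definable, which covers Σ⁰₁ constructively; with mem
-- as the given sets, every arithmetical formula is, and excluded middle is needed
-- only to push negations to the atoms.

module Submission where

open import Defs
open import Axiom.ExcludedMiddle using (ExcludedMiddle)
open import Data.Bool.Base using (Bool; true; false; not; if_then_else_)
open import Data.Bool.Properties using (¬-not)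
open import Data.Empty using (⊥; ⊥-elim)
open import Data.Fin.Base using (Fin; zero; suc; toℕ; fromℕ<; _↑ˡ_; _↑ʳ_)
open import Data.Fin.Patterns
open import Data.Fin.Properties using (toℕ<n; fromℕ<-toℕ)
open import Data.Nat.Base using (ℕ; zero; suc; _+_; _*_; _≤_; _<_; z≤n; s≤s; _⊔_)
open import Data.Nat.Properties
open import Data.Product.Base using (Σ-syntax; ∃-syntax; _×_; _,_; proj₁; proj₂)
open import Data.Sum.Base using (_⊎_; inj₁; inj₂; [_,_]′)
open import Data.Unit.Base using (⊤; tt)
open import Data.Vec.Base using (Vec; []; _∷_; lookup; _++_)
open import Data.Vec.Functional using () renaming (_∷_ to _∷ᶠ_)
open import Data.Vec.Properties using (lookup-++ˡ; lookup-++ʳ; tabulate∘lookup; tabulate-cong)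
open import Function.Base using (_∘_; id)
open import Function.Bundles using (_⇔_; mk⇔; Equivalence)
open import Function.Construct.Composition using (_⇔-∘_)
open import Function.Construct.Symmetry using (⇔-sym)
open import Level using (Lift; lift; 0ℓ) renaming (suc to lsuc)
open import Relation.Binary.Definitions using (tri<; tri≈; tri>)
open import Relation.Binary.PropositionalEquality
  using (_≡_; _≢_; refl; sym; trans; cong; cong₂; subst)
open import Relation.Nullary.Decidable
  using (Dec; yes; no; does; dec-true; dec-false; _→-dec_; decidable-stable)
open import Relation.Nullary.Negation using (¬_; contradiction)
open import Relation.Unary using (Pred; _∈_; _⊆_; _∪_)

-- Partial recursive functions

comp₁⇓ : ∀ {n f} {g : Rec n} {xs a z} →
         g [ xs ]⇓ a → f [ a ∷ [] ]⇓ z → comp f (g ∷ []) [ xs ]⇓ z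
comp₁⇓ dg = comp⇓ λ { 0F → dg }

comp₂⇓ : ∀ {n f} {g h : Rec n} {xs a b z} →
         g [ xs ]⇓ a → h [ xs ]⇓ b → f [ a ∷ b ∷ [] ]⇓ z →
         comp f (g ∷ h ∷ []) [ xs ]⇓ z
comp₂⇓ dg dh = comp⇓ λ { 0F → dg ; 1F → dh }

constᴿ : ∀ {n} → ℕ → Rec n
constᴿ zero    = comp zer []
constᴿ (suc k) = comp succ (constᴿ k ∷ [])

constᴿ⇓ : ∀ {n} {xs : Vec ℕ n} k → constᴿ k [ xs ]⇓ k
constᴿ⇓ zero    = comp⇓ {ys = []} (λ ()) zer⇓
constᴿ⇓ (suc k) = comp₁⇓ (constᴿ⇓ k) succ⇓

addᴿ mulᴿ pairᴿ : Rec 2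
addᴿ  = prim (proj 0F) (comp succ (proj 1F ∷ []))
mulᴿ  = prim (constᴿ 0) (comp addᴿ (proj 2F ∷ proj 1F ∷ []))
pairᴿ = comp addᴿ (comp mulᴿ (addᴿ ∷ addᴿ ∷ []) ∷ proj 0F ∷ [])

addᴿ⇓ : ∀ x y → addᴿ [ x ∷ y ∷ [] ]⇓ x + y
addᴿ⇓ zero    y = prim-zero⇓ proj⇓
addᴿ⇓ (suc x) y = prim-suc⇓ (addᴿ⇓ x y) (comp₁⇓ proj⇓ succ⇓)

mulᴿ⇓ : ∀ x y → mulᴿ [ x ∷ y ∷ [] ]⇓ x * y
mulᴿ⇓ zero    y = prim-zero⇓ (constᴿ⇓ 0)
mulᴿ⇓ (suc x) y = prim-suc⇓ (mulᴿ⇓ x y) (comp₂⇓ proj⇓ proj⇓ (addᴿ⇓ y (x * y)))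

pairᴿ⇓ : ∀ x y → pairᴿ [ x ∷ y ∷ [] ]⇓ ⟨ x , y ⟩
pairᴿ⇓ x y =
  comp₂⇓ (comp₂⇓ (addᴿ⇓ x y) (addᴿ⇓ x y) (mulᴿ⇓ (x + y) (x + y))) proj⇓
         (addᴿ⇓ ((x + y) * (x + y)) x)

termᴿ : ∀ {m} → Term m → Rec m
termᴿ (var x)  = proj x
termᴿ `zero    = constᴿ 0
termᴿ (`suc t) = comp succ (termᴿ t ∷ [])
termᴿ (t `+ u) = comp addᴿ (termᴿ t ∷ termᴿ u ∷ [])
termᴿ (t `* u) = comp mulᴿ (termᴿ t ∷ termᴿ u ∷ [])

termᴿ⇓ : ∀ {m} (t : Term m) ρ → termᴿ t [ ρ ]⇓ ⟦ t ⟧ᵗ ρ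
termᴿ⇓ (var x)  ρ = proj⇓
termᴿ⇓ `zero    ρ = constᴿ⇓ 0
termᴿ⇓ (`suc t) ρ = comp₁⇓ (termᴿ⇓ t ρ) succ⇓
termᴿ⇓ (t `+ u) ρ = comp₂⇓ (termᴿ⇓ t ρ) (termᴿ⇓ u ρ) (addᴿ⇓ (⟦ t ⟧ᵗ ρ) (⟦ u ⟧ᵗ ρ))
termᴿ⇓ (t `* u) ρ = comp₂⇓ (termᴿ⇓ t ρ) (termᴿ⇓ u ρ) (mulᴿ⇓ (⟦ t ⟧ᵗ ρ) (⟦ u ⟧ᵗ ρ))

lookup-injective : ∀ {n} {xs ys : Vec ℕ n} →
                   (∀ i → lookup xs i ≡ lookup ys i) → xs ≡ ys
lookup-injective {xs = xs} {ys} p =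
  trans (sym (tabulate∘lookup xs)) (trans (tabulate-cong p) (tabulate∘lookup ys))

-- Induction on the program. For `mu`, the smaller of two different results would be an argument
-- where `f` is 0 and also a successor.
⇓-det  : ∀ {n} (c : Rec n) {xs y z} → c [ xs ]⇓ y → c [ xs ]⇓ z → y ≡ z
⇓-det* : ∀ {n m} (gs : Vec (Rec n) m) i {xs y z} →
         lookup gs i [ xs ]⇓ y → lookup gs i [ xs ]⇓ z → y ≡ z

⇓-det zer zer⇓ zer⇓ = refl
⇓-det succ succ⇓ succ⇓ = refl
⇓-det (proj i) proj⇓ proj⇓ = refl
⇓-det (comp f gs) (comp⇓ {ys = ys} ds d) (comp⇓ {ys = ys′} es e)
  with refl ← lookup-injective {xs = ys} {ys′} (λ i → ⇓-det* gs i (ds i) (es i)) = ⇓-det f d e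
⇓-det (prim g h) (prim-zero⇓ d) (prim-zero⇓ e) = ⇓-det g d e
⇓-det (prim g h) (prim-suc⇓ d d′) (prim-suc⇓ e e′)
  with refl ← ⇓-det (prim g h) d e = ⇓-det h d′ e′
⇓-det (mu f) {y = y} {z} (mu⇓ d ds) (mu⇓ e es) with <-cmp y z
... | tri< y<z _ _ = contradiction (⇓-det f d (proj₂ (es y y<z))) λ ()
... | tri≈ _ y≡z _ = y≡z
... | tri> _ _ z<y = contradiction (⇓-det f e (proj₂ (ds z z<y))) λ ()

⇓-det* (g ∷ gs) zero    d e = ⇓-det g d e
⇓-det* (g ∷ gs) (suc i) d e = ⇓-det* gs i d e

-- Computability of the reduction

infix 9 X^_·_

X^_·_ : ∀ {L} → ℕ → TeamLTL L → TeamLTL L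
X^ zero  · φ = φ
X^ suc n · φ = X (X^ n · φ)

code-X^ᴿ : ℕ → Rec 1
code-X^ᴿ a = prim (constᴿ a) (comp pairᴿ (constᴿ 4 ∷ proj 1F ∷ []))

code-X^ᴿ⇓ : ∀ {L} (φ : TeamLTL L) n → code-X^ᴿ ⌜ φ ⌝ [ n ∷ [] ]⇓ ⌜ X^ n · φ ⌝
code-X^ᴿ⇓ φ zero    = prim-zero⇓ (constᴿ⇓ _)
code-X^ᴿ⇓ φ (suc n) =
  prim-suc⇓ (code-X^ᴿ⇓ φ n) (comp₂⇓ (constᴿ⇓ 4) proj⇓ (pairᴿ⇓ 4 ⌜ X^ n · φ ⌝))

code-∧X^ᴿ : ℕ → ℕ → Rec 1
code-∧X^ᴿ a b = comp pairᴿ (constᴿ 3 ∷ comp pairᴿ (constᴿ a ∷ code-X^ᴿ b ∷ []) ∷ [])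

-- The family f is a variable, so that no code of a concrete formula is ever computed.
code-∧X^ : ∀ {L} (f : ℕ → TeamLTL L) (φ ψ : TeamLTL L) → (∀ n → f n ≡ φ ∧ X^ n · ψ) →
           Computable₁ (λ n → ⌜ f n ⌝)
code-∧X^ f φ ψ f≡ = code-∧X^ᴿ ⌜ φ ⌝ ⌜ ψ ⌝ , λ { (n ∷ []) →
  subst (λ χ → code-∧X^ᴿ ⌜ φ ⌝ ⌜ ψ ⌝ [ n ∷ [] ]⇓ ⌜ χ ⌝) (sym (f≡ n))
    (comp₂⇓ (constᴿ⇓ 3)
            (comp₂⇓ (constᴿ⇓ ⌜ φ ⌝) (code-X^ᴿ⇓ ψ n) (pairᴿ⇓ ⌜ φ ⌝ ⌜ X^ n · ψ ⌝))
            (pairᴿ⇓ 3 ⟨ ⌜ φ ⌝ , ⌜ X^ n · ψ ⌝ ⟩)) }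

-- First-order formulas over ternary relations

data Sym : Set where
  less seq mem : Sym

-- Negation normal form: rel false is the negated atom.
data Fm (n : ℕ) : Set where
  rel     : Bool → Sym → Fin n → Fin n → Fin n → Fm n
  _⋀_ _⋁_ : Fm n → Fm n → Fm n
  all ex  : Fm (suc n) → Fm n

infixr 7 _⋀_
infixr 6 _⋁_

-- Positive and negative atoms are interpreted separately, because the readings obtained from a team
-- are shown to exclude each other only afterwards.
Literal : Set₁
Literal = Bool → Sym → ℕ → ℕ → ℕ → Set

Interp : Set
Interp = Sym → ℕ → ℕ → ℕ → Bool

literal : Interp → Literal
literal I b s x y z = I s x y z ≡ b

⟦_⟧ᶠ : ∀ {n} → Fm n → Literal → Vec ℕ n → Set
⟦ rel b s x y z ⟧ᶠ H ρ = H b s (lookup ρ x) (lookup ρ y) (lookup ρ z)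
⟦ φ ⋀ ψ ⟧ᶠ H ρ = ⟦ φ ⟧ᶠ H ρ × ⟦ ψ ⟧ᶠ H ρ
⟦ φ ⋁ ψ ⟧ᶠ H ρ = ⟦ φ ⟧ᶠ H ρ ⊎ ⟦ ψ ⟧ᶠ H ρ
⟦ all φ ⟧ᶠ H ρ = ∀ a → ⟦ φ ⟧ᶠ H (a ∷ ρ)
⟦ ex φ  ⟧ᶠ H ρ = ∃[ a ] ⟦ φ ⟧ᶠ H (a ∷ ρ)

⟦⟧ᶠ-mono : ∀ {H H′ : Literal} → (∀ {b s x y z} → H b s x y z → H′ b s x y z) →
           ∀ {n} (φ : Fm n) {ρ} → ⟦ φ ⟧ᶠ H ρ → ⟦ φ ⟧ᶠ H′ ρ
⟦⟧ᶠ-mono h (rel b s x y z) p        = h p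
⟦⟧ᶠ-mono h (φ ⋀ ψ)         (p , q)  = ⟦⟧ᶠ-mono h φ p , ⟦⟧ᶠ-mono h ψ q
⟦⟧ᶠ-mono h (φ ⋁ ψ)         (inj₁ p) = inj₁ (⟦⟧ᶠ-mono h φ p)
⟦⟧ᶠ-mono h (φ ⋁ ψ)         (inj₂ q) = inj₂ (⟦⟧ᶠ-mono h ψ q)
⟦⟧ᶠ-mono h (all φ)         p        = λ a → ⟦⟧ᶠ-mono h φ (p a)
⟦⟧ᶠ-mono h (ex φ)          (a , p)  = a , ⟦⟧ᶠ-mono h φ p

-- A binary relation is encoded as a ternary one by repeating its second argument.
Standard : Interp → Set
Standard I = ∀ x y → I less x y y ≡ does (x <? y)

lt ge eq isSuc : ∀ {n} → Fin n → Fin n → Fm n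
lt x y = rel true less x y y
ge x y = rel false less x y y
eq x y = ge x y ⋀ ge y x
isSuc x y = lt x y ⋀ all (ge (suc x) 0F ⋁ ge 0F (suc y))

isZero : ∀ {n} → Fin n → Fm n
isZero x = all (ge 0F (suc x))

-- `seq p x y` is read as: the sequence coded by p has entry y at place x.
functionalSeq : ∀ {n} → Fm n
functionalSeq = all (all (all (all
  (rel false seq 3F 2F 1F ⋁ rel false seq 3F 2F 0F ⋁ eq 1F 0F))))

exs : ∀ {n} k → Fm (k + n) → Fm n
exs zero    φ = φ
exs (suc k) φ = exs k (ex φ)

-- `σ` lists the variables holding the arguments and `y` is the variable holding the result.
graph  : ∀ {m n} → Rec m → (Fin m → Fin n) → Fin n → Fm n
graphs : ∀ {m k n} → Vec (Rec m) k → (Fin m → Fin n) → (Fin k → Fin n) → Fm n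
-- Variable 0 is a place k and variable 1 the code of a sequence whose entry at k + 1 must come from
-- the entry at k by `h`.
primStep : ∀ {m n} → Rec (2 + m) → (Fin m → Fin n) → Fm (2 + n)

primStep h σ =
  ex (ex (ex (isSuc 3F 2F ⋀ rel true seq 4F 3F 1F ⋀ rel true seq 4F 2F 0F ⋀
              graph h (3F ∷ᶠ 1F ∷ᶠ λ i → suc (suc (suc (suc (suc (σ i)))))) 0F)))

graph zer      σ y = isZero y
graph succ     σ y = isSuc (σ 0F) y
graph (proj i) σ y = eq (σ i) y
graph {n = n} (comp {k} f gs) σ y =
  exs k (graphs gs (λ i → k ↑ʳ σ i) (_↑ˡ n) ⋀ graph f (_↑ˡ n) (k ↑ʳ y))
-- The outermost ex guesses a code of the sequence of values of the recursion.
graph (prim g h) σ y =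
  ex (ex (ex (isZero 1F ⋀ rel true seq 2F 1F 0F ⋀
              graph g (λ i → suc (suc (suc (σ (suc i))))) 0F))
      ⋀ rel true seq 0F (suc (σ 0F)) (suc y)
      ⋀ all (ge 0F (suc (suc (σ 0F))) ⋁ primStep h (σ ∘ suc)))
graph (mu f) σ y =
  ex (isZero 0F ⋀ graph f (suc y ∷ᶠ λ i → suc (σ i)) 0F)
  ⋀ all (ge 0F (suc y) ⋁
         ex (ex (isSuc 1F 0F ⋀ graph f (2F ∷ᶠ λ i → suc (suc (suc (σ i)))) 0F)))

-- A valid formula, standing for the empty conjunction.
graphs []       σ τ = all (ge 0F 0F)
graphs (g ∷ gs) σ τ = graph g σ (τ 0F) ⋀ graphs gs σ (τ ∘ suc)

-- Correctness of the defining formulas in standard interpretations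

module _ {H : Literal} where

  exs⇒ : ∀ {n} k {φ : Fm (k + n)} {ρ} → ⟦ exs k φ ⟧ᶠ H ρ → ∃[ ys ] ⟦ φ ⟧ᶠ H (ys ++ ρ)
  exs⇒ zero    p = [] , p
  exs⇒ (suc k) p with ys , a , q ← exs⇒ k p = a ∷ ys , q

  ⇒exs : ∀ {n} k {φ : Fm (k + n)} {ρ} ys → ⟦ φ ⟧ᶠ H (ys ++ ρ) → ⟦ exs k φ ⟧ᶠ H ρ
  ⇒exs zero    []       p = p
  ⇒exs (suc k) (a ∷ ys) p = ⇒exs k ys (a , p)

does-true : ∀ {P : Set} (P? : Dec P) → does P? ≡ true → P
does-true (yes p) _ = p

does-false : ∀ {P : Set} (P? : Dec P) → does P? ≡ false → ¬ P
does-false (no ¬p) _ = ¬p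

module Arithmetic {I : Interp} (std : Standard I) where

  private H = literal I

  module _ {x y : ℕ} where

    lt⇒< : H true less x y y → x < y
    lt⇒< p = does-true (x <? y) (trans (sym (std x y)) p)

    <⇒lt : x < y → H true less x y y
    <⇒lt p = trans (std x y) (dec-true (x <? y) p)

    ge⇒≮ : H false less x y y → ¬ x < y
    ge⇒≮ p = does-false (x <? y) (trans (sym (std x y)) p)

    ≮⇒ge : ¬ x < y → H false less x y y
    ≮⇒ge p = trans (std x y) (dec-false (x <? y) p)

  module _ {n} (ρ : Vec ℕ n) (x y : Fin n) where

    eq⇒ : ⟦ eq x y ⟧ᶠ H ρ → lookup ρ x ≡ lookup ρ y
    eq⇒ (p , q) = ≤-antisym (≮⇒≥ (ge⇒≮ q)) (≮⇒≥ (ge⇒≮ p))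

    ⇒eq : lookup ρ x ≡ lookup ρ y → ⟦ eq x y ⟧ᶠ H ρ
    ⇒eq e = ≮⇒ge (<-irrefl e) , ≮⇒ge (<-irrefl (sym e))

    isSuc⇒ : ⟦ isSuc x y ⟧ᶠ H ρ → lookup ρ y ≡ suc (lookup ρ x)
    -- The successor of the first number is the instance to test: it must not lie strictly between
    -- the two.
    isSuc⇒ (p , q) with q (suc (lookup ρ x))
    ... | inj₁ r = ⊥-elim (ge⇒≮ r ≤-refl)
    ... | inj₂ r = ≤-antisym (≮⇒≥ (ge⇒≮ r)) (lt⇒< p)

    ⇒isSuc : lookup ρ y ≡ suc (lookup ρ x) → ⟦ isSuc x y ⟧ᶠ H ρ
    ⇒isSuc e = <⇒lt (≤-reflexive (sym e)) , between
      where
      between : ∀ z → H false less (lookup ρ x) z z ⊎ H false less z (lookup ρ y) (lookup ρ y)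
      between z with lookup ρ x <? z
      ... | no  x≮z = inj₁ (≮⇒ge x≮z)
      ... | yes x<z = inj₂ (≮⇒ge λ z<y → <⇒≱ z<y (≤-trans (≤-reflexive e) x<z))

  module _ {n} (ρ : Vec ℕ n) (x : Fin n) where

    isZero⇒ : ⟦ isZero x ⟧ᶠ H ρ → lookup ρ x ≡ 0
    isZero⇒ p = n≤0⇒n≡0 (≮⇒≥ (ge⇒≮ (p 0)))

    ⇒isZero : lookup ρ x ≡ 0 → ⟦ isZero x ⟧ᶠ H ρ
    ⇒isZero e _ = ≮⇒ge (≤⇒≯ (≤-trans (≤-reflexive e) z≤n))

  functionalSeq⇒ : ∀ {n} {ρ : Vec ℕ n} → ⟦ functionalSeq ⟧ᶠ H ρ →
                   ∀ {p x y z} → I seq p x y ≡ true → I seq p x z ≡ true → y ≡ z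
  functionalSeq⇒ {ρ = ρ} h {p} {x} {y} {z} sy sz with h p x y z
  ... | inj₁ r        = contradiction (trans (sym sy) r) λ ()
  ... | inj₂ (inj₁ r) = contradiction (trans (sym sz) r) λ ()
  ... | inj₂ (inj₂ r) = eq⇒ (z ∷ y ∷ x ∷ p ∷ ρ) 1F 0F r

  -- Induction on `f`. For primitive recursion the guessed code is followed entry by entry;
  -- functionality of `seq` identifies the entries read by each step, and by the final clause, with
  -- the values reached so far.
  graph⇒⇓ : (∀ {p x y z} → I seq p x y ≡ true → I seq p x z ≡ true → y ≡ z) →
            ∀ {m n} (f : Rec m) {ρ : Vec ℕ n} {σ y vs v} →
            (∀ i → lookup ρ (σ i) ≡ lookup vs i) → lookup ρ y ≡ v →
            ⟦ graph f σ y ⟧ᶠ H ρ → f [ vs ]⇓ v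
  graph⇒⇓ functional = sound
    where
    sound  : ∀ {m n} (f : Rec m) {ρ : Vec ℕ n} {σ y vs v} →
             (∀ i → lookup ρ (σ i) ≡ lookup vs i) → lookup ρ y ≡ v →
             ⟦ graph f σ y ⟧ᶠ H ρ → f [ vs ]⇓ v
    sounds : ∀ {m n k} (gs : Vec (Rec m) k) {ρ : Vec ℕ n} {σ τ vs ws} →
             (∀ i → lookup ρ (σ i) ≡ lookup vs i) → (∀ i → lookup ρ (τ i) ≡ lookup ws i) →
             ⟦ graphs gs σ τ ⟧ᶠ H ρ → ∀ i → lookup gs i [ vs ]⇓ lookup ws i

    sound zer {ρ} {y = y} {vs = []} e refl p rewrite isZero⇒ ρ y p = zer⇓
    sound succ {ρ} {σ} {y} {vs = _ ∷ []} e refl p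
      rewrite isSuc⇒ ρ (σ 0F) y p | e 0F = succ⇓
    sound (proj i) {ρ} {σ} {y} e refl p
      rewrite sym (eq⇒ ρ (σ i) y p) | e i = proj⇓
    sound (comp {k} f gs) {ρ} {σ} {y} e refl p with ys , ps , q ← exs⇒ k p =
      comp⇓ {ys = ys}
            (sounds gs {ws = ys} (λ i → trans (lookup-++ʳ ys ρ (σ i)) (e i)) (lookup-++ˡ ys ρ) ps)
            (sound f {vs = ys} (lookup-++ˡ ys ρ) (lookup-++ʳ ys ρ y) q)
    sound (prim g h) {ρ} {σ} {y} {v₀ ∷ vs} e refl (p , (o , w , o≡0 , sw , dg) , sy , steps) =
      let w′ , sw′ , d = run v₀ ≤-refl
      in  subst (prim g h [ v₀ ∷ vs ]⇓_)
                (functional sw′ (subst (λ x → I seq p x (lookup ρ y) ≡ true) (e 0F) sy)) d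
      where
      run : ∀ k → k ≤ v₀ → ∃[ w ] I seq p k w ≡ true × prim g h [ k ∷ vs ]⇓ w
      run zero _ =
        w , subst (λ x → I seq p x w ≡ true) (isZero⇒ (w ∷ o ∷ p ∷ ρ) 1F o≡0) sw ,
        prim-zero⇓ (sound g (e ∘ suc) refl dg)
      run (suc k) k<v with run k (<⇒≤ k<v) | steps k
      ... | _ | inj₁ k≮v = ⊥-elim (ge⇒≮ k≮v (subst (k <_) (sym (e 0F)) k<v))
      ... | w , sw , d | inj₂ (k′ , u , v , k′≡ , su , sv , dh)
        with refl ← isSuc⇒ (v ∷ u ∷ k′ ∷ k ∷ p ∷ ρ) 3F 2F k′≡ | refl ← functional sw su =
        v , sv ,
        prim-suc⇓ d (sound h (λ { 0F → refl ; 1F → refl ; (suc (suc i)) → e (suc i) }) refl dh)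
    sound (mu f) {ρ} {σ} {y} {vs} e refl ((z , z≡0 , d) , below) =
      mu⇓ (sound f (λ { 0F → refl ; (suc i) → e i }) (isZero⇒ (z ∷ ρ) 0F z≡0) d) nonzero
      where
      nonzero : ∀ x → x < lookup ρ y → ∃[ w ] f [ x ∷ vs ]⇓ suc w
      nonzero x x<y with below x
      ... | inj₁ x≮y = ⊥-elim (ge⇒≮ x≮y x<y)
      ... | inj₂ (w , w′ , w′≡ , d′) =
        w , sound f (λ { 0F → refl ; (suc i) → e i }) (isSuc⇒ (w′ ∷ w ∷ x ∷ ρ) 1F 0F w′≡) d′

    sounds (g ∷ gs) e e′ (p , ps) zero    = sound g e (e′ 0F) p
    sounds (g ∷ gs) {ws = _ ∷ ws} e e′ (p , ps) (suc i) = sounds gs {ws = ws} e (e′ ∘ suc) ps i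

  -- Induction on `f`. A derivation of a primitive recursion contains all intermediate values, and a
  -- code of them is the witness for the outermost quantifier.
  ⇓⇒graph : (∀ (w : ℕ → ℕ) k → ∃[ p ] (∀ x → x < k → I seq p x (w x) ≡ true)) →
            ∀ {m n} (f : Rec m) {ρ : Vec ℕ n} {σ y vs v} →
            (∀ i → lookup ρ (σ i) ≡ lookup vs i) → lookup ρ y ≡ v →
            f [ vs ]⇓ v → ⟦ graph f σ y ⟧ᶠ H ρ
  ⇓⇒graph sequence = complete
    where
    complete  : ∀ {m n} (f : Rec m) {ρ : Vec ℕ n} {σ y vs v} →
                (∀ i → lookup ρ (σ i) ≡ lookup vs i) → lookup ρ y ≡ v →
                f [ vs ]⇓ v → ⟦ graph f σ y ⟧ᶠ H ρ
    completes : ∀ {m n k} (gs : Vec (Rec m) k) {ρ : Vec ℕ n} {σ τ vs ws} →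
                (∀ i → lookup ρ (σ i) ≡ lookup vs i) → (∀ i → lookup ρ (τ i) ≡ lookup ws i) →
                (∀ i → lookup gs i [ vs ]⇓ lookup ws i) → ⟦ graphs gs σ τ ⟧ᶠ H ρ

    -- The intermediate values are gathered into one function so that they can be coded; beyond `x`
    -- it repeats the last value.
    values : ∀ {n} {g : Rec n} {h x xs y} → prim g h [ x ∷ xs ]⇓ y →
             Σ[ w ∈ (ℕ → ℕ) ] w x ≡ y × g [ xs ]⇓ w 0 ×
               (∀ k → k < x → h [ k ∷ w k ∷ xs ]⇓ w (suc k))
    values {y = y} (prim-zero⇓ d) = (λ _ → y) , refl , d , λ _ ()
    values {g = g} {h} {suc x} {xs} {y} (prim-suc⇓ d d′) with w , refl , d₀ , ds ← values d =
      w′ , w′-above , subst (g [ xs ]⇓_) (sym (w′-below z≤n)) d₀ , steps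
      where
      w′ : ℕ → ℕ
      w′ k = if does (k ≤? x) then w k else y
      w′-below : ∀ {k} → k ≤ x → w′ k ≡ w k
      w′-below {k} k≤x rewrite dec-true (k ≤? x) k≤x = refl
      w′-above : w′ (suc x) ≡ y
      w′-above rewrite dec-false (suc x ≤? x) (<-irrefl refl) = refl
      steps : ∀ k → k < suc x → h [ k ∷ w′ k ∷ xs ]⇓ w′ (suc k)
      steps k (s≤s k≤x) with m≤n⇒m<n∨m≡n k≤x
      ... | inj₁ k<x rewrite w′-below k≤x | w′-below k<x = ds k k<x
      ... | inj₂ refl rewrite w′-below k≤x | w′-above = d′

    complete zer {ρ} {y = y} e e′ zer⇓ = ⇒isZero ρ y e′
    complete succ {ρ} {σ} {y} e e′ succ⇓ =
      ⇒isSuc ρ (σ 0F) y (trans e′ (cong suc (sym (e 0F))))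
    complete (proj i) {ρ} {σ} {y} e e′ proj⇓ = ⇒eq ρ (σ i) y (trans (e i) (sym e′))
    complete (comp {k} f gs) {ρ} {σ} {y} e e′ (comp⇓ {ys = ys} ds d) =
      ⇒exs k ys
        ( completes gs {ws = ys} (λ i → trans (lookup-++ʳ ys ρ (σ i)) (e i)) (lookup-++ˡ ys ρ) ds
        , complete f {vs = ys} (lookup-++ˡ ys ρ) (trans (lookup-++ʳ ys ρ y) e′) d )
    complete (prim g h) {ρ} {σ} {y} {v₀ ∷ vs} e refl d with w , wy , dg , dh ← values d =
      -- The length is `suc v₀` because the result itself, entry `v₀`, is read too.
      let p , s = sequence w (suc v₀)
          x     = lookup ρ (σ 0F)
      in  p ,
          (0 , w 0 , ⇒isZero (w 0 ∷ 0 ∷ p ∷ ρ) 1F refl , s 0 (s≤s z≤n) ,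
           complete g (e ∘ suc) refl dg) ,
          subst (λ u → I seq p x u ≡ true) (trans (cong w (e 0F)) wy)
                (s x (s≤s (≤-reflexive (e 0F)))) ,
          λ k → steps p s k
      where
      steps : ∀ p → (∀ x → x < suc v₀ → I seq p x (w x) ≡ true) → ∀ k →
              ⟦ ge 0F (suc (suc (σ 0F))) ⋁ primStep h (σ ∘ suc) ⟧ᶠ H (k ∷ p ∷ ρ)
      steps p s k with k <? lookup ρ (σ 0F)
      ... | no  k≮x = inj₁ (≮⇒ge k≮x)
      ... | yes k<x = let k<v = subst (k <_) (e 0F) k<x in
        inj₂ (suc k , w k , w (suc k) ,
              ⇒isSuc (w (suc k) ∷ w k ∷ suc k ∷ k ∷ p ∷ ρ) 3F 2F refl ,
              s k (m≤n⇒m≤1+n k<v) , s (suc k) (s≤s k<v) ,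
              complete h (λ { 0F → refl ; 1F → refl ; (suc (suc i)) → e (suc i) }) refl (dh k k<v))
    complete (mu f) {ρ} {σ} {y} e refl (mu⇓ d ds) =
      (0 , ⇒isZero (0 ∷ ρ) 0F refl , complete f (λ { 0F → refl ; (suc i) → e i }) refl d) ,
      below
      where
      below : ∀ x → _
      below x with x <? lookup ρ y
      ... | no  x≮y = inj₁ (≮⇒ge x≮y)
      ... | yes x<y with w , d′ ← ds x x<y =
        inj₂ (w , suc w , ⇒isSuc (suc w ∷ w ∷ x ∷ ρ) 1F 0F refl ,
              complete f (λ { 0F → refl ; (suc i) → e i }) refl d′)

    completes [] e e′ ds a = ≮⇒ge (<-irrefl refl)
    completes (g ∷ gs) {ws = _ ∷ ws} e e′ ds =
      complete g e (e′ 0F) (ds 0F) , completes gs {ws = ws} e (e′ ∘ suc) (ds ∘ suc)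

-- Sequences coded by numbers

-- One step of Cantor's enumeration of pairs along the antidiagonals.
nextPair : ℕ × ℕ → ℕ × ℕ
nextPair (a , zero)  = zero , suc a
nextPair (a , suc b) = suc a , b

unpair : ℕ → ℕ × ℕ
unpair zero    = 0 , 0
unpair (suc n) = nextPair (unpair n)

-- The enumeration is walked backwards: along the antidiagonal down to its first pair, then to the
-- last pair of the antidiagonal before.
unpair-surjective : ∀ a b → ∃[ n ] unpair n ≡ (a , b)
unpair-surjective a b = go (a + b) a b refl
  where
  go : ∀ s a b → a + b ≡ s → ∃[ n ] unpair n ≡ (a , b)
  go zero    zero    zero    _ = 0 , refl
  go (suc s) zero    (suc b) e with n , p ← go s b 0 (trans (+-identityʳ b) (suc-injective e)) =
    suc n , cong nextPair p
  go s       (suc a) b       e with n , p ← go s a (suc b) (trans (+-suc a b) e) =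
    suc n , cong nextPair p

-- The sum grows, by one, only when a new antidiagonal starts. The bound keeps the first entry of a
-- code below the code and makes codes arbitrarily large.
unpair-≤ : ∀ n → proj₁ (unpair n) + proj₂ (unpair n) ≤ n
unpair-≤ zero = z≤n
unpair-≤ (suc n) with unpair n | unpair-≤ n
... | a , zero  | a+0≤n = s≤s (≤-trans (m≤m+n a 0) a+0≤n)
... | a , suc b | a+1+b≤n = s≤s (≤-trans (+-monoʳ-≤ a (n≤1+n b)) a+1+b≤n)

-- Every number codes an infinite sequence: its first component is the head, its second one codes
-- the tail. In the canonical team, entries 0, 1 and 2 of a position are its labels.
elem : ℕ → ℕ → ℕ
elem p zero    = proj₁ (unpair p)
elem p (suc k) = elem (proj₂ (unpair p)) k

elem₀-≤ : ∀ p → elem p 0 ≤ p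
elem₀-≤ p = ≤-trans (m≤m+n _ _) (unpair-≤ p)

-- The code is built from the back, starting with `i` as the tail, and pairing never makes it
-- smaller. The lower bound is what lets every triple of labels recur.
elem-surjective : ∀ (w : ℕ → ℕ) k i → ∃[ p ] i ≤ p × (∀ x → x < k → elem p x ≡ w x)
elem-surjective w zero    i = i , ≤-refl , λ _ ()
elem-surjective w (suc k) i with r , i≤r , h ← elem-surjective (w ∘ suc) k i
                             with p , e ← unpair-surjective (w 0) r =
  p , ≤-trans i≤r (subst (λ q → proj₂ q ≤ p) e (≤-trans (m≤n+m _ _) (unpair-≤ p))) , entries
  where
  entries : ∀ x → x < suc k → elem p x ≡ w x
  entries zero    _         = cong proj₁ e
  entries (suc x) (s≤s x<k) = trans (cong (λ q → elem (proj₂ q) x) e) (h x x<k)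

-- Translation of first-order formulas

⊤ᴸ ⊥ᴸ : LTL
⊤ᴸ = atom 0 ∨ natom 0
⊥ᴸ = atom 0 ∧ natom 0

Fᴸ Gᴸ : LTL → LTL
Fᴸ φ = ⊤ᴸ U φ
Gᴸ φ = φ W ⊥ᴸ

holds-⊤ᴸ : ∀ t i → ⟦ ⊤ᴸ ⟧ t i
holds-⊤ᴸ t i with t i 0
... | true  = inj₁ refl
... | false = inj₂ refl

Gᴸ-elim : ∀ φ t {i} → ⟦ Gᴸ φ ⟧ t i → ∀ k → i ≤ k → ⟦ φ ⟧ t k
Gᴸ-elim φ t g k i≤k with g k i≤k
... | inj₁ p = p
... | inj₂ (_ , _ , _ , p , q) = contradiction (trans (sym p) q) λ ()

module Translation (L : Logic) where
  -- With truth on the left, the inclusion atom forces a non-empty team to contain a trace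
  -- satisfying `ψ`; with truth on the right, every trace is matched with one satisfying truth and
  -- so satisfies `ψ`.
  some every : LTL → TeamLTL L
  some ψ  = incl (⊤ᴸ ∷ []) (ψ ∷ [])
  every ψ = incl (ψ ∷ []) (⊤ᴸ ∷ [])

  -- `some ⊤ᴸ` holds in every team, whereas `atom 0 ∧ natom 0` fails only in non-empty ones;
  -- eliminating `G` therefore takes a member of the team.
  F G : TeamLTL L → TeamLTL L
  F φ = some ⊤ᴸ U φ
  G φ = φ W (atom 0 ∧ natom 0)

  -- A trace of a team stands for a number v playing a role r: it satisfies
  -- role r at all positions, number at position v, and label l at position j
  -- iff v is the l-th of the three numbers assigned to j. The proposition
  -- symbol s holds at j iff the relation s holds of these three numbers.
  label : Fin 3 → AP
  label = toℕ

  number : AP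
  number = 3

  symbol : Sym → AP
  symbol less = 4
  symbol seq  = 5
  symbol mem  = 6

  role : ℕ → AP
  role r = 7 + r

  litᵀ : Bool → AP → TeamLTL L
  litᵀ true  p = atom p
  litᵀ false p = natom p

  -- The left half of the splitting can only absorb traces outside role `r`, so the literal binds
  -- all traces in that role.
  on : ℕ → Bool → AP → TeamLTL L
  on r b p = natom (role r) ∨ litᵀ b p

  window noWindow : ℕ → ℕ → ℕ → TeamLTL L
  window x y z   = on x true (label 0F) ∧ on y true (label 1F) ∧ on z true (label 2F)
  noWindow x y z = on x false (label 0F) ∨ᴮ on y false (label 1F) ∨ᴮ on z false (label 2F)

  -- An atom is evaluated at the positions whose labels are the three numbers. The first conjunct
  -- makes these recur, so that opposite claims clash; the second fixes the symbol at all of them.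
  relation : Bool → Sym → ℕ → ℕ → ℕ → TeamLTL L
  relation b s x y z = G (F (window x y z)) ∧ G (noWindow x y z ∨ᴮ litᵀ b (symbol s))

  fresh : ∀ {n} → ℕ → Vec ℕ n → TeamLTL L
  fresh d []       = some ⊤ᴸ
  fresh d (r ∷ rs) = on r false (role d) ∧ fresh d rs

  -- The disjunction discards the traces of role d that violate p now. The first
  -- two conjuncts keep it from discarding all of them, or any trace chosen before.
  pick : ∀ {n} → AP → ℕ → Vec ℕ n → TeamLTL L → TeamLTL L
  pick p d rs φ = some (Gᴸ (atom (role d)) ∧ atom p) ∧ fresh d rs ∧
                  ((atom (role d) ∧ natom p) ∨ φ)

  -- The quantifier at depth `n` uses role `n`, and `rs` gives the role of each variable. The number
  -- chosen is label 0 of the position that time has reached.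
  translate : ∀ {n} → Fm n → Vec ℕ n → TeamLTL L
  translate (rel b s x y z) rs = relation b s (lookup rs x) (lookup rs y) (lookup rs z)
  translate (φ ⋀ ψ) rs = translate φ rs ∧ translate ψ rs
  translate (φ ⋁ ψ) rs = translate φ rs ∨ᴮ translate ψ rs
  translate {n = n} (all φ) rs = G (pick (label 0F) n rs (translate φ (n ∷ rs)))
  translate {n = n} (ex φ)  rs = F (pick (label 0F) n rs (translate φ (n ∷ rs)))

  -- Imposed on the team, this yields a truth value for every triple, from which an interpretation
  -- is read off.
  decided : Sym → Fm 0
  decided s = all (all (all (rel true s 2F 1F 0F ⋁ rel false s 2F 1F 0F)))

  rigid : AP → TeamLTL L
  rigid p = G (atom p ∨ᴮ natom p)

  conj₃ : (Fin 3 → TeamLTL L) → TeamLTL L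
  conj₃ φ = φ 0F ∧ φ 1F ∧ φ 2F

  conjSym : (Sym → TeamLTL L) → TeamLTL L
  conjSym φ = φ less ∧ φ seq ∧ φ mem

  -- With labelRigid and traceShape, this makes label 0 of a position determine a number.
  apart : TeamLTL L
  apart = on 0 false (label 0F) ∨ᴮ on 1 false (label 0F)

  -- With number p in role 0, `above` is evaluated at the positions q > p and `notBelow` at the
  -- positions q ≥ p; choosing by `number` there puts q into role 1.
  above notBelow : TeamLTL L
  above    = pick number 1 (0 ∷ []) (relation true less 0 1 1 ∧ G apart)
  notBelow = pick number 1 (0 ∷ []) (relation false less 1 0 0)

  increasing decreasing : TeamLTL L
  increasing = G (pick number 0 [] (X (G above)))
  decreasing = G (pick number 0 [] (G notBelow))

  -- The first conjunct gives every trace a number and keeps label 0 away from it before that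
  -- position; the second makes its number reachable by a universal quantifier arbitrarily late.
  traceShape : LTL
  traceShape = (natom (label 0F) U atom number) ∧ Gᴸ (Fᴸ (atom (label 0F)))

  -- At position a the splitting cannot discard the traces with number a, which must therefore agree
  -- on the label from then on.
  labelRigid : Fin 3 → TeamLTL L
  labelRigid l = natom number ∨ rigid (label l)

  setup : TeamLTL L
  setup = conjSym (λ s → rigid (symbol s))
        ∧ conj₃ (λ l → G (labelRigid l))
        ∧ every traceShape
        ∧ increasing
        ∧ decreasing
        ∧ conjSym (λ s → translate (decided s) [])

  -- Evaluated at position n, this puts the input n itself into role 0.
  body : Fm 1 → TeamLTL L
  body φ = pick number 0 [] (translate φ (0 ∷ []))

  -- From teams to interpretations

  -- A record, so that φ can be inferred from S , i ⊩ φ and is not unfolded.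
  record _,_⊩_ (S : Pred Trace 0ℓ) (i : ℕ) (φ : TeamLTL L) : Set₁ where
    constructor ⟪_⟫
    field unwrap : S , i ⊨ φ

  infix 4 _,_⊩_

  open _,_⊩_

  record Setup (T : Pred Trace 0ℓ) : Set₁ where
    field
      symbolsRigid : ∀ s → T , 0 ⊩ rigid (symbol s)
      labelsRigid  : ∀ l → T , 0 ⊩ G (labelRigid l)
      shape        : T , 0 ⊩ every traceShape
      increases    : T , 0 ⊩ increasing
      decreases    : T , 0 ⊩ decreasing
      decides      : ∀ s → T , 0 ⊩ translate (decided s) []

  setup⇒ : ∀ {T} → T , 0 ⊨ setup → Setup T
  setup⇒ ((s₀ , s₁ , s₂) , (l₀ , l₁ , l₂) , sh , inc , dec , d₀ , d₁ , d₂) = record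
    { symbolsRigid = λ { less → ⟪ s₀ ⟫ ; seq → ⟪ s₁ ⟫ ; mem → ⟪ s₂ ⟫ }
    ; labelsRigid  = λ { 0F → ⟪ l₀ ⟫ ; 1F → ⟪ l₁ ⟫ ; 2F → ⟪ l₂ ⟫ }
    ; shape        = ⟪ sh ⟫
    ; increases    = ⟪ inc ⟫
    ; decreases    = ⟪ dec ⟫
    ; decides      = λ { less → ⟪ d₀ ⟫ ; seq → ⟪ d₁ ⟫ ; mem → ⟪ d₂ ⟫ }
    }

  ⇒setup : ∀ {T} → Setup T → T , 0 ⊨ setup
  ⇒setup s = (unwrap (symbolsRigid less) , unwrap (symbolsRigid seq) , unwrap (symbolsRigid mem))
           , (unwrap (labelsRigid 0F) , unwrap (labelsRigid 1F) , unwrap (labelsRigid 2F))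
           , unwrap shape , unwrap increases , unwrap decreases
           , unwrap (decides less) , unwrap (decides seq) , unwrap (decides mem)
    where
    open Setup s

  module _ {S : Pred Trace 0ℓ} {t : Trace} (t∈S : t ∈ S) {i : ℕ} where

    some-elim : ∀ {ψ} → S , i ⊩ some ψ → ∃[ t′ ] t′ ∈ S × ⟦ ψ ⟧ t′ i
    some-elim ⟪ lift h ⟫ with t′ , t′∈S , e ← h t∈S =
      t′ , t′∈S , Equivalence.to (e 0F) (holds-⊤ᴸ t i)

    every-elim : ∀ {ψ} → S , i ⊩ every ψ → ⟦ ψ ⟧ t i
    every-elim ⟪ lift h ⟫ with t′ , t′∈S , e ← h t∈S =
      Equivalence.from (e 0F) (holds-⊤ᴸ t′ i)

    G-elim : ∀ {φ : TeamLTL L} → S , i ⊩ G φ → ∀ k → i ≤ k → S , k ⊩ φ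
    G-elim ⟪ g ⟫ k i≤k with g k i≤k
    ... | inj₁ p = ⟪ p ⟫
    ... | inj₂ (_ , _ , _ , lift p , lift q) = contradiction (trans (sym (p t∈S)) (q t∈S)) λ ()

    litᵀ-elim : ∀ b {p} → S , i ⊩ litᵀ b p → t i p ≡ b
    litᵀ-elim true  ⟪ lift h ⟫ = h t∈S
    litᵀ-elim false ⟪ lift h ⟫ = h t∈S

  module _ {S : Pred Trace 0ℓ} {t : Trace} (t∈S : t ∈ S) where

    on-elim : ∀ b {i r p} → S , i ⊩ on r b p → t i (role r) ≡ true → t i p ≡ b
    on-elim b ⟪ S₁ , S₂ , (_ , S⊆) , lift off , h ⟫ has with S⊆ t∈S
    ... | inj₁ t∈S₁ = contradiction (trans (sym has) (off t∈S₁)) λ ()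
    ... | inj₂ t∈S₂ = litᵀ-elim t∈S₂ b ⟪ h ⟫

    rigid-elim : ∀ {p t′ i} → t′ ∈ S → S , i ⊩ rigid p → ∀ k → i ≤ k → t k p ≡ t′ k p
    rigid-elim t′∈S g k i≤k with G-elim t∈S g k i≤k
    ... | ⟪ inj₁ (lift h) ⟫ = trans (h t∈S) (sym (h t′∈S))
    ... | ⟪ inj₂ (lift h) ⟫ = trans (h t∈S) (sym (h t′∈S))

  Player : Pred Trace 0ℓ → ℕ → ℕ → Pred Trace 0ℓ → Set
  Player S i r P = ∃[ t ] t ∈ S × (∀ j → i ≤ j → t j (role r) ≡ true) × P t

  Numbered : ℕ → Pred Trace 0ℓ
  Numbered a t = t a number ≡ true

  Players : ∀ {n} → Pred Trace 0ℓ → ℕ → Vec ℕ n → Vec ℕ n → Set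
  Players S i rs ρ = ∀ x → Player S i (lookup rs x) (Numbered (lookup ρ x))

  delay : ∀ {S i k r P} → i ≤ k → Player S i r P → Player S k r P
  delay i≤k (t , t∈S , roles , p) = t , t∈S , (λ j k≤j → roles j (≤-trans i≤k k≤j)) , p

  fresh-elim : ∀ {S i n d} (rs : Vec ℕ n) → S , i ⊩ fresh d rs → ∀ {t} → t ∈ S →
               ∀ x → t i (role (lookup rs x)) ≡ true → t i (role d) ≡ false
  fresh-elim (_ ∷ _)  ⟪ p , _ ⟫  t∈S zero    = on-elim t∈S false ⟪ p ⟫
  fresh-elim (_ ∷ rs) ⟪ _ , ps ⟫ t∈S (suc x) = fresh-elim rs ⟪ ps ⟫ t∈S x

  -- The trace named by the first conjunct satisfies `p` and survives the splitting. Discarded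
  -- traces have role `d`, which `fresh` denies to the players chosen earlier, so those survive as
  -- well.
  pick-elim : ∀ {S k n p d} {rs : Vec ℕ n} ρ {φ : TeamLTL L} {t} → t ∈ S →
              S , k ⊩ pick p d rs φ → Players S k rs ρ →
              Σ[ S′ ∈ Pred Trace 0ℓ ] S′ ⊆ S × Players S′ k rs ρ ×
                Player S′ k d (λ t → t k p ≡ true) × (S′ , k ⊩ φ)
  pick-elim {k = k} {d = d} {rs} ρ t∈S
    ⟪ e , f , S₁ , S₂ , (⊆S , S⊆) , (lift inRole , lift off) , h ⟫ ps
    with t′ , t′∈S , roles , now ← some-elim t∈S ⟪ e ⟫ =
    S₂ , ⊆S ∘ inj₂ , old , (t′ , t′∈S₂ , Gᴸ-elim (atom (role d)) t′ roles , now) , ⟪ h ⟫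
    where
    t′∈S₂ : t′ ∈ S₂
    t′∈S₂ with S⊆ t′∈S
    ... | inj₁ t′∈S₁ = contradiction (trans (sym now) (off t′∈S₁)) λ ()
    ... | inj₂ t′∈S₂ = t′∈S₂
    old : Players S₂ k rs ρ
    old x with τ , τ∈S , τroles , τnum ← ps x with S⊆ τ∈S
    ... | inj₁ τ∈S₁ = contradiction
            (trans (sym (inRole τ∈S₁)) (fresh-elim rs ⟪ f ⟫ τ∈S x (τroles k ≤-refl))) λ ()
    ... | inj₂ τ∈S₂ = τ , τ∈S₂ , τroles , τnum

  X^-elim : ∀ {S i} n {φ : TeamLTL L} → S , i ⊨ X^ n · φ → S , n + i ⊩ φ
  X^-elim zero    h = ⟪ h ⟫
  X^-elim {S} {i} (suc n) {φ} h = subst (λ j → S , j ⊩ φ) (+-suc n i) (X^-elim n h)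

  X^-intro : ∀ {S i} n {φ : TeamLTL L} → S , n + i ⊩ φ → S , i ⊨ X^ n · φ
  X^-intro zero    h = unwrap h
  X^-intro {S} {i} (suc n) {φ} h = X^-intro n (subst (λ j → S , j ⊩ φ) (sym (+-suc n i)) h)

  module Extract {T : Pred Trace 0ℓ} {t₀ : Trace} (t₀∈T : t₀ ∈ T)
                 (model : Setup T) where

    open Setup model

    symbol-global : ∀ s {t} → t ∈ T → ∀ j → t j (symbol s) ≡ t₀ j (symbol s)
    symbol-global s t∈T j = rigid-elim t∈T t₀∈T (symbolsRigid s) j z≤n

    label-determined : ∀ l {a t t′} → t ∈ T → t′ ∈ T → Numbered a t → Numbered a t′ →
                       ∀ j → a ≤ j → t j (label l) ≡ t′ j (label l)
    label-determined l {a} t∈T t′∈T na n′a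
      with ⟪ S₁ , S₂ , (_ , T⊆) , lift off , h ⟫ ← G-elim t₀∈T (labelsRigid l) a z≤n
      with T⊆ t∈T | T⊆ t′∈T
    ... | inj₁ p | _      = contradiction (trans (sym na) (off p)) λ ()
    ... | inj₂ _ | inj₁ p = contradiction (trans (sym n′a) (off p)) λ ()
    ... | inj₂ p | inj₂ q = rigid-elim p q ⟪ h ⟫

    numbered : ∀ {t} → t ∈ T →
               ∃[ a ] Numbered a t × (∀ j → j < a → t j (label 0F) ≡ false)
    numbered t∈T with (a , _ , na , before) , _ ← every-elim t∈T shape =
      a , na , λ j → before j z≤n

    recurrent : ∀ {t} → t ∈ T → ∀ i → ∃[ k ] i ≤ k × t k (label 0F) ≡ true
    recurrent {t} t∈T i with _ , r ← every-elim t∈T shape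
                    with k , i≤k , p , _ ← Gᴸ-elim (Fᴸ (atom (label 0F))) t r i z≤n = k , i≤k , p

    first : ∀ p → Σ[ S ∈ Pred Trace 0ℓ ] S ⊆ T × Player S p 0 (Numbered p) × (S , suc p ⊩ G above)
    first p with S , S⊆T , _ , pl , ⟪ h ⟫ ←
                   pick-elim [] t₀∈T (G-elim t₀∈T increases p z≤n) (λ ()) =
      S , S⊆T , pl , ⟪ h ⟫

    abstract
      -- A fixed representative speaks for all traces numbered `a`, since their labels agree from
      -- position `a` on.
      rep : ∀ a → Σ[ t ∈ Trace ] t ∈ T × Numbered a t
      rep a with _ , S⊆T , (t , t∈S , _ , na) , _ ← first a = t , S⊆T t∈S , na

    Window : ℕ → ℕ → ℕ → ℕ → Set
    Window x y z j = proj₁ (rep x) j (label 0F) ≡ true ×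
                     proj₁ (rep y) j (label 1F) ≡ true ×
                     proj₁ (rep z) j (label 2F) ≡ true

    -- The truth value of an atom in the limit. Windows before `from` are disregarded because a
    -- number determines the labels of its traces only from its own position on.
    record Eventually (b : Bool) (s : Sym) (x y z : ℕ) : Set where
      constructor eventually
      field
        from    : ℕ
        value   : ∀ j → from ≤ j → Window x y z j → t₀ j (symbol s) ≡ b
        windows : ∀ i → ∃[ k ] i ≤ k × Window x y z k

    -- A window later than both thresholds carries both values.
    coherent : ∀ {b b′ s x y z} → Eventually b s x y z → Eventually b′ s x y z → b ≡ b′
    coherent (eventually i v w) (eventually i′ v′ w′)
      with k , i⊔i′≤k , win ← w (i ⊔ i′) =
      trans (sym (v k (≤-trans (m≤m⊔n i i′) i⊔i′≤k) win))
            (v′ k (≤-trans (m≤n⊔m i i′) i⊔i′≤k) win)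

    -- Beyond `late` the players carry the labels of the representatives of their numbers, so the
    -- windows of the roles are the windows of the numbers.
    relation-elim : ∀ {b s r₀ r₁ r₂ S i x y z} → S ⊆ T →
                    Player S i r₀ (Numbered x) → Player S i r₁ (Numbered y) →
                    Player S i r₂ (Numbered z) →
                    S , i ⊩ relation b s r₀ r₁ r₂ → Eventually b s x y z
    relation-elim {b} {s} {r₀} {r₁} {r₂} {S} {i} {x} {y} {z} S⊆T
      (t , t∈S , tr , tn) (u , u∈S , ur , un) (v , v∈S , vr , vn) ⟪ often , always ⟫ =
      eventually late value windows
      where
      late = i ⊔ (x ⊔ (y ⊔ z))
      module _ {j} (late≤j : late ≤ j) where
        i≤j : i ≤ j
        i≤j = m⊔n≤o⇒m≤o i _ late≤j
        eqˣ : t j (label 0F) ≡ proj₁ (rep x) j (label 0F)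
        eqˣ = label-determined 0F (S⊆T t∈S) (proj₁ (proj₂ (rep x))) tn (proj₂ (proj₂ (rep x))) j
                (m⊔n≤o⇒m≤o x _ (m⊔n≤o⇒n≤o i _ late≤j))
        eqʸ : u j (label 1F) ≡ proj₁ (rep y) j (label 1F)
        eqʸ = label-determined 1F (S⊆T u∈S) (proj₁ (proj₂ (rep y))) un (proj₂ (proj₂ (rep y))) j
                (m⊔n≤o⇒m≤o y z (m⊔n≤o⇒n≤o x _ (m⊔n≤o⇒n≤o i _ late≤j)))
        eqᶻ : v j (label 2F) ≡ proj₁ (rep z) j (label 2F)
        eqᶻ = label-determined 2F (S⊆T v∈S) (proj₁ (proj₂ (rep z))) vn (proj₂ (proj₂ (rep z))) j
                (m⊔n≤o⇒n≤o y z (m⊔n≤o⇒n≤o x _ (m⊔n≤o⇒n≤o i _ late≤j)))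
      clash : ∀ {c : Bool} → c ≡ true → c ≡ false → ⊥
      clash refl ()
      value : ∀ j → late ≤ j → Window x y z j → t₀ j (symbol s) ≡ b
      value j h (p , q , r)
        with G-elim t∈S {φ = noWindow r₀ r₁ r₂ ∨ᴮ litᵀ b (symbol s)} ⟪ always ⟫ j (i≤j h)
      ... | ⟪ inj₁ (inj₁ off) ⟫ =
        ⊥-elim (clash (trans (eqˣ h) p) (on-elim t∈S false ⟪ off ⟫ (tr j (i≤j h))))
      ... | ⟪ inj₁ (inj₂ (inj₁ off)) ⟫ =
        ⊥-elim (clash (trans (eqʸ h) q) (on-elim u∈S false ⟪ off ⟫ (ur j (i≤j h))))
      ... | ⟪ inj₁ (inj₂ (inj₂ off)) ⟫ =
        ⊥-elim (clash (trans (eqᶻ h) r) (on-elim v∈S false ⟪ off ⟫ (vr j (i≤j h))))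
      ... | ⟪ inj₂ lit ⟫ = trans (sym (symbol-global s (S⊆T t∈S) j)) (litᵀ-elim t∈S b ⟪ lit ⟫)
      windows : ∀ i′ → ∃[ k ] i′ ≤ k × Window x y z k
      windows i′
        with ⟪ k , m≤k , (p , q , r) , _ ⟫ ←
               G-elim t∈S {φ = F (window r₀ r₁ r₂)} ⟪ often ⟫ (late ⊔ i′)
                 (≤-trans (m≤m⊔n i _) (m≤m⊔n late i′)) =
        let h   = ≤-trans (m≤m⊔n late i′) m≤k
            i≤k = i≤j h
        in  k , ≤-trans (m≤n⊔m late i′) m≤k ,
            trans (sym (eqˣ h)) (on-elim t∈S true ⟪ p ⟫ (tr k i≤k)) ,
            trans (sym (eqʸ h)) (on-elim u∈S true ⟪ q ⟫ (ur k i≤k)) ,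
            trans (sym (eqᶻ h)) (on-elim v∈S true ⟪ r ⟫ (vr k i≤k))

    -- `increasing` is instantiated at position p and then at q, which produces players with exactly
    -- these numbers.
    ordered : ∀ {p q} → p < q →
              Eventually true less p q q ×
              (∀ j → q ≤ j → proj₁ (rep p) j (label 0F) ≡ true →
                proj₁ (rep q) j (label 0F) ≡ false)
    ordered {p} {q} p<q
      with S , S⊆T , pl@(t , t∈S , _) , h ← first p
      with S′ , S′⊆S , old , new@(v , v∈S′ , vr , vn) , ⟪ less′ , disj ⟫ ←
             pick-elim (p ∷ []) t∈S (G-elim t∈S h q p<q)
               (λ { 0F → delay (<⇒≤ p<q) pl })
      with u , u∈S′ , ur , un ← old 0F =
      relation-elim (S⊆T ∘ S′⊆S) (old 0F) new new ⟪ less′ ⟫ , disjoint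
      where
      disjoint : ∀ j → q ≤ j → proj₁ (rep p) j (label 0F) ≡ true →
                 proj₁ (rep q) j (label 0F) ≡ false
      disjoint j q≤j has with G-elim u∈S′ {φ = apart} ⟪ disj ⟫ j q≤j
      ... | ⟪ inj₁ off ⟫ = contradiction
        (trans (sym has) (trans (label-determined 0F (proj₁ (proj₂ (rep p))) (S⊆T (S′⊆S u∈S′))
                                   (proj₂ (proj₂ (rep p))) un j (≤-trans (<⇒≤ p<q) q≤j))
                                (on-elim u∈S′ false ⟪ off ⟫ (ur j q≤j)))) λ ()
      ... | ⟪ inj₂ off ⟫ =
        trans (label-determined 0F (proj₁ (proj₂ (rep q))) (S⊆T (S′⊆S v∈S′))
                 (proj₂ (proj₂ (rep q))) vn j q≤j)
              (on-elim v∈S′ false ⟪ off ⟫ (vr j q≤j))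

    unordered : ∀ {p q} → p ≤ q → Eventually false less q p p
    unordered {p} {q} p≤q
      with S , S⊆T , _ , pl@(t , t∈S , _) , h ←
             pick-elim [] t₀∈T (G-elim t₀∈T decreases p z≤n) (λ ())
      with S′ , S′⊆S , old , new , less′ ←
             pick-elim (p ∷ []) t∈S (G-elim t∈S h q p≤q)
               (λ { 0F → delay p≤q pl }) =
      relation-elim (S⊆T ∘ S′⊆S) new (old 0F) (old 0F) less′

    -- Suppose the number a′ of `t` differs from `a`. If a′ exceeds `k`, then `t` cannot be labelled
    -- at `k` yet; otherwise both numbers are at most `k`, and the representatives of distinct
    -- numbers no longer share label 0.
    labelled⇒numbered : ∀ {a k t} → t ∈ T → a ≤ k → proj₁ (rep a) k (label 0F) ≡ true →
                        t k (label 0F) ≡ true → Numbered a t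
    labelled⇒numbered {a} {k} {t} t∈T a≤k ea et with a′ , na′ , before ← numbered t∈T
      with <-cmp a a′
    ... | tri≈ _ refl _ = na′
    ... | tri< a<a′ _ _ with a′ ≤? k
    ...   | no  a′≰k = contradiction (trans (sym et) (before k (≰⇒> a′≰k))) λ ()
    ...   | yes a′≤k = contradiction
        (trans (sym (trans (sym (label-determined 0F t∈T (proj₁ (proj₂ (rep a′))) na′
                                   (proj₂ (proj₂ (rep a′))) k a′≤k)) et))
               (proj₂ (ordered a<a′) k a′≤k ea)) λ ()
    labelled⇒numbered {a} {k} {t} t∈T a≤k ea et | tri> _ _ a′<a = contradiction
        (trans (sym ea)
               (proj₂ (ordered a′<a) k a≤k
                 (trans (sym (label-determined 0F t∈T (proj₁ (proj₂ (rep _))) na′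
                                (proj₂ (proj₂ (rep _))) k (≤-trans (<⇒≤ a′<a) a≤k))) et))) λ ()

    -- For a universal quantifier, `G` is used at a position where label 0 is on the representative
    -- of `a`; the trace kept there then has number `a`. For an existential one, the kept trace
    -- supplies the number.
    translate-elim : ∀ {n} (φ : Fm n) {rs ρ S i t} → t ∈ S → S ⊆ T → Players S i rs ρ →
                     S , i ⊩ translate φ rs → ⟦ φ ⟧ᶠ Eventually ρ
    translate-elim (rel b s x y z) t∈S S⊆T ps h =
      relation-elim S⊆T (ps x) (ps y) (ps z) h
    translate-elim (φ ⋀ ψ) t∈S S⊆T ps ⟪ p , q ⟫ =
      translate-elim φ t∈S S⊆T ps ⟪ p ⟫ , translate-elim ψ t∈S S⊆T ps ⟪ q ⟫
    translate-elim (φ ⋁ ψ) t∈S S⊆T ps ⟪ inj₁ p ⟫ = inj₁ (translate-elim φ t∈S S⊆T ps ⟪ p ⟫)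
    translate-elim (φ ⋁ ψ) t∈S S⊆T ps ⟪ inj₂ q ⟫ = inj₂ (translate-elim ψ t∈S S⊆T ps ⟪ q ⟫)
    translate-elim {n} (all φ) {rs} {ρ} {S} {i} t∈S S⊆T ps h a
      -- The position lies past `i` for the use of `G` and past `a` for the label to identify the
      -- number.
      with k , i⊔a≤k , ea ← recurrent (proj₁ (proj₂ (rep a))) (i ⊔ a)
      with i≤k ← ≤-trans (m≤m⊔n i a) i⊔a≤k
      with S′ , S′⊆S , old , (u , u∈S′ , ur , eu) , h′ ←
             pick-elim ρ t∈S (G-elim t∈S h k i≤k) (λ x → delay i≤k (ps x)) =
      translate-elim φ u∈S′ (S⊆T ∘ S′⊆S)
        (λ { zero → u , u∈S′ , ur ,
               labelled⇒numbered (S⊆T (S′⊆S u∈S′)) (≤-trans (m≤n⊔m i a) i⊔a≤k) ea eu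
           ; (suc x) → old x })
        h′
    translate-elim {n} (ex φ) {rs} {ρ} {S} {i} t∈S S⊆T ps ⟪ k , i≤k , h , _ ⟫
      with S′ , S′⊆S , old , (u , u∈S′ , ur , eu) , h′ ←
             pick-elim {rs = rs} ρ {translate φ (n ∷ rs)} t∈S ⟪ h ⟫ (λ x → delay i≤k (ps x))
      with a , na , _ ← numbered (S⊆T (S′⊆S u∈S′)) =
      a , translate-elim φ u∈S′ (S⊆T ∘ S′⊆S)
            (λ { zero → u , u∈S′ , ur , na ; (suc x) → old x }) h′

    abstract
      decide : ∀ s x y z → Eventually true s x y z ⊎ Eventually false s x y z
      decide s = translate-elim (decided s) {[]} {[]} t₀∈T id (λ ()) (decides s)

    value : ∀ {s x y z} → Eventually true s x y z ⊎ Eventually false s x y z → Bool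
    value (inj₁ _) = true
    value (inj₂ _) = false

    value-unique : ∀ {b s x y z} (d : Eventually true s x y z ⊎ Eventually false s x y z) →
                   Eventually b s x y z → value d ≡ b
    value-unique (inj₁ p) = coherent p
    value-unique (inj₂ p) = coherent p

    interp : Interp
    interp s x y z = value (decide s x y z)

    Eventually⇒interp : ∀ {b s x y z} → Eventually b s x y z → interp s x y z ≡ b
    Eventually⇒interp {s = s} {x} {y} {z} = value-unique (decide s x y z)

    interp-standard : Standard interp
    interp-standard x y = by (x <? y)
      where
      by : ∀ (d : Dec (x < y)) → interp less x y y ≡ does d
      by (yes x<y) = Eventually⇒interp (proj₁ (ordered x<y))
      by (no  x≮y) = Eventually⇒interp (unordered (≮⇒≥ x≮y))

    body-elim : ∀ φ n → T , n ⊩ body φ → ⟦ φ ⟧ᶠ (literal interp) (n ∷ [])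
    body-elim φ n h
      with S , S⊆T , _ , pl@(t , t∈S , _) , h′ ← pick-elim [] t₀∈T h (λ ()) =
      ⟦⟧ᶠ-mono Eventually⇒interp φ (translate-elim φ t∈S S⊆T (λ { 0F → pl }) h′)

  -- From interpretations to teams

  F-intro : ∀ {S i k φ} → i ≤ k → S , k ⊩ φ → S , i ⊩ F φ
  F-intro {k = k} i≤k ⟪ h ⟫ =
    ⟪ k , i≤k , h , (λ m _ _ → lift λ {t} t∈S → t , t∈S , λ { 0F → mk⇔ id id }) ⟫

  G-intro : ∀ {S i φ} → (∀ k → i ≤ k → S , k ⊩ φ) → S , i ⊩ G φ
  G-intro h = ⟪ (λ k i≤k → inj₁ (unwrap (h k i≤k))) ⟫

  module Canonical (I : Interp) (std : Standard I) where

    -- The labels of position `j` are the first three entries of the sequence it codes, and a trace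
    -- keeps its role at all times.
    trace : ℕ → ℕ → Trace
    trace r v j 0 = does (elem j 0 ≟ v)
    trace r v j 1 = does (elem j 1 ≟ v)
    trace r v j 2 = does (elem j 2 ≟ v)
    trace r v j 3 = does (j ≟ v)
    trace r v j 4 = I less (elem j 0) (elem j 1) (elem j 2)
    trace r v j 5 = I seq (elem j 0) (elem j 1) (elem j 2)
    trace r v j 6 = I mem (elem j 0) (elem j 1) (elem j 2)
    trace r v j (suc (suc (suc (suc (suc (suc (suc q))))))) = does (r ≟ q)

    trace-label : ∀ {r v j} l → trace r v j (label l) ≡ does (elem j (toℕ l) ≟ v)
    trace-label 0F = refl
    trace-label 1F = refl
    trace-label 2F = refl

    trace-symbol : ∀ {r v j} s → trace r v j (symbol s) ≡ I s (elem j 0) (elem j 1) (elem j 2)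
    trace-symbol less = refl
    trace-symbol seq  = refl
    trace-symbol mem  = refl

    Roles : Set₁
    Roles = ℕ → ℕ → Set

    -- Subteams are described by which numbers occur in which role, so decidable conditions on these
    -- give splittings constructively.
    Team : Roles → Pred Trace 0ℓ
    Team P t = ∃[ r ] ∃[ v ] t ≡ trace r v × P r v

    litᵀ-intro : ∀ b {P k p} → (∀ {r v} → P r v → trace r v k p ≡ b) → Team P , k ⊩ litᵀ b p
    litᵀ-intro true  h = ⟪ lift (λ { (_ , _ , refl , p) → h p }) ⟫
    litᵀ-intro false h = ⟪ lift (λ { (_ , _ , refl , p) → h p }) ⟫

    ∨-intro : ∀ {Q : Roles} → (∀ r v → Dec (Q r v)) → ∀ {P k φ ψ} →
              Team (λ r v → P r v × ¬ Q r v) , k ⊩ φ → Team (λ r v → P r v × Q r v) , k ⊩ ψ →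
              Team P , k ⊩ (φ ∨ ψ)
    ∨-intro {Q} Q? {P} ⟪ g ⟫ ⟪ h ⟫ = ⟪ _ , _ , (join , split) , g , h ⟫
      where
      join : (Team (λ r v → P r v × ¬ Q r v) ∪ Team (λ r v → P r v × Q r v)) ⊆ Team P
      join (inj₁ (r , v , e , p , _)) = r , v , e , p
      join (inj₂ (r , v , e , p , _)) = r , v , e , p
      split : Team P ⊆ (Team (λ r v → P r v × ¬ Q r v) ∪ Team (λ r v → P r v × Q r v))
      split (r , v , e , p) with Q? r v
      ... | yes q = inj₂ (r , v , e , p , q)
      ... | no ¬q = inj₁ (r , v , e , p , ¬q)

    on-intro : ∀ b {P k r p} → (∀ {v} → P r v → trace r v k p ≡ b) → Team P , k ⊩ on r b p
    on-intro b {P} {k} {r} {p} h =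
      ∨-intro (λ r′ _ → r′ ≟ r) (litᵀ-intro false λ { {r′} (_ , r′≢r) → dec-false (r′ ≟ r) r′≢r })
              (litᵀ-intro b λ { (p , refl) → h p })

    some-intro : ∀ {P k ψ} r v → P r v → ⟦ ψ ⟧ (trace r v) k → Team P , k ⊩ some ψ
    some-intro {k = k} r v p h =
      ⟪ lift (λ {t} _ → trace r v , (r , v , refl , p) ,
                     λ { 0F → mk⇔ (λ _ → h) (λ _ → holds-⊤ᴸ t k) }) ⟫

    every-intro : ∀ {P k ψ} → (∀ {r v} → P r v → ⟦ ψ ⟧ (trace r v) k) → Team P , k ⊩ every ψ
    every-intro {k = k} h =
      ⟪ lift (λ { (r , v , refl , p) → trace r v , (r , v , refl , p) ,
                     λ { 0F → mk⇔ (λ _ → holds-⊤ᴸ (trace r v) k) (λ _ → h p) } }) ⟫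

    rigid-intro : ∀ {P i p} (b : ℕ → Bool) → (∀ {r v} j → P r v → trace r v j p ≡ b j) →
                  Team P , i ⊩ rigid p
    rigid-intro {P} {i} {p} b h = G-intro λ k _ → at k (b k) (h k)
      where
      at : ∀ k c → (∀ {r v} → P r v → trace r v k p ≡ c) → Team P , k ⊩ (atom p ∨ᴮ natom p)
      at k true  e = ⟪ inj₁ (unwrap (litᵀ-intro true e)) ⟫
      at k false e = ⟪ inj₂ (unwrap (litᵀ-intro false e)) ⟫

    -- The invariant at depth `n`: the roles of variables contain no number but the assigned one,
    -- while all roles from `n` on are still complete.
    record Fits (P : Roles) (n : ℕ) (rs ρ : Vec ℕ n) : Set where
      field
        assigned : ∀ x {v} → P (lookup rs x) v → v ≡ lookup ρ x
        below    : ∀ x → lookup rs x < n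
        free     : ∀ {r} → n ≤ r → ∀ v → P r v

    open Fits

    narrow : Roles → ℕ → ℕ → Roles
    narrow P n a r v = P r v × (r ≡ n → v ≡ a)

    Fits-narrow : ∀ {P n rs ρ} a → Fits P n rs ρ → Fits (narrow P n a) (suc n) (n ∷ rs) (a ∷ ρ)
    Fits-narrow a f .assigned zero    (_ , e) = e refl
    Fits-narrow a f .assigned (suc x) (p , _) = assigned f x p
    Fits-narrow a f .below zero    = ≤-refl
    Fits-narrow a f .below (suc x) = m≤n⇒m≤1+n (below f x)
    Fits-narrow a f .free n<r v    = free f (<⇒≤ n<r) v , λ { refl → ⊥-elim (<-irrefl refl n<r) }

    fresh-intro : ∀ {P k n m} (rs : Vec ℕ m) → P n 0 → (∀ x → lookup rs x < n) →
                  Team P , k ⊩ fresh n rs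
    fresh-intro {k = k} {n} [] p h = some-intro n 0 p (holds-⊤ᴸ (trace n 0) k)
    fresh-intro {n = n} (r ∷ rs) p h =
      ⟪ unwrap (on-intro false {p = role n} λ _ → dec-false (r ≟ n) (<⇒≢ (h 0F)))
      , unwrap (fresh-intro rs p (h ∘ suc)) ⟫

    -- The discarded half consists of the traces in role `n` whose number is not `a`; at `k` they
    -- violate `p`.
    pick-intro : ∀ {P n rs ρ a p k φ} → Fits P n rs ρ →
                 (∀ {r v} → trace r v k p ≡ does (a ≟ v)) →
                 Team (narrow P n a) , k ⊩ φ → Team P , k ⊩ pick p n rs φ
    pick-intro {P} {n} {rs} {ρ} {a} {p} {k} f h g =
      ⟪ unwrap (some-intro {ψ = Gᴸ (atom (role n)) ∧ atom p} n a (free f ≤-refl a)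
          ((λ j _ → inj₁ (dec-true (n ≟ n) refl)) , trans h (dec-true (a ≟ a) refl)))
      , unwrap (fresh-intro rs (free f ≤-refl 0) (below f))
      , unwrap (∨-intro (λ r v → (r ≟ n) →-dec (v ≟ a)) {φ = atom (role n) ∧ natom p}
          ⟪ unwrap (litᵀ-intro true {p = role n} λ { {r} {v} (_ , ¬q) →
               dec-true (r ≟ n)
                 (decidable-stable (r ≟ n) λ r≢n → ¬q λ r≡n → contradiction r≡n r≢n) })
          , unwrap (litᵀ-intro false λ { {r} {v} (_ , ¬q) →
               trans h (dec-false (a ≟ v) λ a≡v → ¬q λ _ → sym a≡v) }) ⟫
          g) ⟫

    -- Arbitrarily large positions code a sequence beginning with x, y, z. Any position either has a
    -- label that differs, and is no window, or gives the symbol its value in `I`.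
    relation-intro : ∀ {P i r₀ r₁ r₂ x y z s b} →
                     (∀ {v} → P r₀ v → v ≡ x) → (∀ {v} → P r₁ v → v ≡ y) →
                     (∀ {v} → P r₂ v → v ≡ z) → I s x y z ≡ b →
                     Team P , i ⊩ relation b s r₀ r₁ r₂
    relation-intro {P} {i} {r₀} {r₁} {r₂} {x} {y} {z} {s} {b} px py pz val =
      ⟪ unwrap (G-intro λ k _ → often k) , unwrap (G-intro λ k _ → always k) ⟫
      where
      yes-at : ∀ {k l v u} → v ≡ u → elem k l ≡ u → does (elem k l ≟ v) ≡ true
      yes-at {k} {l} refl refl = dec-true (elem k l ≟ elem k l) refl
      no-at : ∀ {k l v u} → v ≡ u → elem k l ≢ u → does (elem k l ≟ v) ≡ false
      no-at {k} {l} {v} refl e = dec-false (elem k l ≟ v) e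
      often : ∀ k → Team P , k ⊩ F (window r₀ r₁ r₂)
      often k
        with p , k≤p , e ← elem-surjective (λ { 0 → x ; 1 → y ; _ → z }) 3 k =
        F-intro k≤p
          ⟪ unwrap (on-intro true {p = label 0F} λ q → yes-at {p} {0} (px q) (e 0 (s≤s z≤n)))
          , unwrap (on-intro true {p = label 1F} λ q → yes-at {p} {1} (py q) (e 1 (s≤s (s≤s z≤n))))
          , unwrap (on-intro true {p = label 2F} λ q → yes-at {p} {2} (pz q) (e 2 ≤-refl)) ⟫
      always : ∀ k → Team P , k ⊩ (noWindow r₀ r₁ r₂ ∨ᴮ litᵀ b (symbol s))
      always k with elem k 0 ≟ x | elem k 1 ≟ y | elem k 2 ≟ z
      ... | no e | _ | _ =
        ⟪ inj₁ (inj₁ (unwrap (on-intro false {p = label 0F} λ q → no-at {k} {0} (px q) e))) ⟫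
      ... | yes _ | no e | _ =
        ⟪ inj₁ (inj₂ (inj₁ (unwrap (on-intro false {p = label 1F} λ q → no-at {k} {1} (py q) e)))) ⟫
      ... | yes _ | yes _ | no e =
        ⟪ inj₁ (inj₂ (inj₂ (unwrap (on-intro false {p = label 2F} λ q → no-at {k} {2} (pz q) e)))) ⟫
      ... | yes e₀ | yes e₁ | yes e₂ =
        ⟪ inj₂ (unwrap (litᵀ-intro b λ _ → trans (trace-symbol s)
            (trans (cong₂ (λ u w → I s u w (elem k 2)) e₀ e₁) (trans (cong (I s x y) e₂) val)))) ⟫

    translate-intro : ∀ {n} (φ : Fm n) {rs ρ P i} → Fits P n rs ρ →
                      ⟦ φ ⟧ᶠ (literal I) ρ → Team P , i ⊩ translate φ rs
    translate-intro (rel b s x y z) f h =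
      relation-intro (assigned f x) (assigned f y) (assigned f z) h
    translate-intro (φ ⋀ ψ) f (p , q) =
      ⟪ unwrap (translate-intro φ f p) , unwrap (translate-intro ψ f q) ⟫
    translate-intro (φ ⋁ ψ) f (inj₁ p) = ⟪ inj₁ (unwrap (translate-intro φ f p)) ⟫
    translate-intro (φ ⋁ ψ) f (inj₂ q) = ⟪ inj₂ (unwrap (translate-intro ψ f q)) ⟫
    translate-intro (all φ) f h = G-intro λ k _ →
      pick-intro f refl (translate-intro φ (Fits-narrow (elem k 0) f) (h (elem k 0)))
    translate-intro {n} (ex φ) {rs} {ρ} {P} {i} f (a , h)
      with k , i≤k , e ← elem-surjective (λ _ → a) 1 i =
      F-intro i≤k (pick-intro f (λ {_} {v} → cong (λ u → does (u ≟ v)) (e 0 (s≤s z≤n)))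
                                (translate-intro φ (Fits-narrow a f) h))

    Everything : Roles
    Everything _ _ = ⊤

    Fits-[] : Fits Everything 0 [] []
    Fits-[] = record { assigned = λ () ; below = λ () ; free = λ _ _ → tt }

    canonical : Setup (Team Everything)
    canonical = record
      { symbolsRigid = λ s → rigid-intro _ λ _ _ → trace-symbol s
      ; labelsRigid  = λ l → G-intro λ k _ → ∨-intro (λ _ v → k ≟ v)
          (litᵀ-intro false λ { {_} {v} (_ , k≢v) → dec-false (k ≟ v) k≢v })
          (rigid-intro (λ j → does (elem j (toℕ l) ≟ k)) λ { j (_ , refl) → trace-label l })
      ; shape        = every-intro λ {r} {v} _ →
          (v , z≤n , dec-true (v ≟ v) refl ,
           -- Label 0 of a position never exceeds the position, so it is not `v` before `v`.
           λ m _ m<v → dec-false (elem m 0 ≟ v) (<⇒≢ (≤-<-trans (elem₀-≤ m) m<v))) ,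
          λ k _ → inj₁ (recurs r v k)
      ; increases    = G-intro λ p _ → pick-intro Fits-[] refl
          ⟪ unwrap (G-intro λ q p<q → pick-intro (Fits-narrow p Fits-[]) refl (above-intro p<q)) ⟫
      ; decreases    = G-intro λ p _ → pick-intro Fits-[] refl
          (G-intro λ q p≤q → pick-intro (Fits-narrow p Fits-[]) refl (notBelow-intro p≤q))
      ; decides      = λ s → translate-intro (decided s) Fits-[] λ x y z → bool (I s x y z)
      }
      where
      bool : ∀ b → b ≡ true ⊎ b ≡ false
      bool true  = inj₁ refl
      bool false = inj₂ refl
      recurs : ∀ r v k → ⟦ Fᴸ (atom (label 0F)) ⟧ (trace r v) k
      recurs r v k with p , k≤p , e ← elem-surjective (λ _ → v) 1 k =
        p , k≤p , dec-true (elem p 0 ≟ v) (e 0 (s≤s z≤n)) , λ m _ _ → holds-⊤ᴸ (trace r v) m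
      both : ∀ p q → Fits (narrow (narrow Everything 0 p) 1 q) 2 (1 ∷ 0 ∷ []) (q ∷ p ∷ [])
      both p q = Fits-narrow q (Fits-narrow p Fits-[])
      above-intro : ∀ {p q} → p < q → Team (narrow (narrow Everything 0 p) 1 q) , q ⊩
                                        (relation true less 0 1 1 ∧ G apart)
      above-intro {p} {q} p<q =
        ⟪ unwrap (relation-intro (assigned (both p q) 1F) (assigned (both p q) 0F)
            (assigned (both p q) 0F) (trans (std p q) (dec-true (p <? q) p<q)))
        , unwrap (G-intro λ j _ → separate j) ⟫
        where
        separate : ∀ j → Team (narrow (narrow Everything 0 p) 1 q) , j ⊩ apart
        separate j with elem j 0 ≟ p
        ... | no  e = ⟪ inj₁ (unwrap (on-intro false {p = label 0F} λ { {v} h →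
                dec-false (elem j 0 ≟ v) λ e′ → e (trans e′ (assigned (both p q) 1F h)) })) ⟫
        ... | yes e = ⟪ inj₂ (unwrap (on-intro false {p = label 0F} λ { {v} h →
                dec-false (elem j 0 ≟ v) λ e′ →
                  <⇒≢ p<q (trans (sym e) (trans e′ (assigned (both p q) 0F h))) })) ⟫
      notBelow-intro : ∀ {p q} → p ≤ q → Team (narrow (narrow Everything 0 p) 1 q) , q ⊩
                                           relation false less 1 0 0
      notBelow-intro {p} {q} p≤q =
        relation-intro (assigned (both p q) 0F) (assigned (both p q) 1F)
            (assigned (both p q) 1F) (trans (std q p) (dec-false (q <? p) (≤⇒≯ p≤q)))

    body-intro : ∀ φ n → ⟦ φ ⟧ᶠ (literal I) (n ∷ []) → Team Everything , n ⊩ body φ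
    body-intro φ n h = pick-intro Fits-[] refl (translate-intro φ (Fits-narrow n Fits-[]) h)

  -- The reduction and its correctness

  reduction : Fm 1 → ℕ → TeamLTL L
  reduction φ n = setup ∧ X^ n · body φ

  reduction-correct : ∀ φ n →
    SAT L (reduction φ n) ⇔ (Σ[ I ∈ Interp ] Standard I × ⟦ φ ⟧ᶠ (literal I) (n ∷ []))
  reduction-correct φ n = mk⇔ to from
    where
    to : SAT L (reduction φ n) → Σ[ I ∈ Interp ] Standard I × ⟦ φ ⟧ᶠ (literal I) (n ∷ [])
    to (T , (t , t∈T) , s , b) =
      E.interp , E.interp-standard ,
      E.body-elim φ n (subst (λ j → T , j ⊩ body φ) (+-identityʳ n) (X^-elim n b))
      where module E = Extract t∈T (setup⇒ s)
    from : (Σ[ I ∈ Interp ] Standard I × ⟦ φ ⟧ᶠ (literal I) (n ∷ [])) → SAT L (reduction φ n)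
    from (I , std , h) =
      C.Team C.Everything , (C.trace 0 0 , 0 , 0 , refl , tt) ,
      ⇒setup C.canonical ,
      X^-intro n (subst (λ j → C.Team C.Everything , j ⊩ body φ) (sym (+-identityʳ n))
                         (C.body-intro φ n h))
      where module C = Canonical I std

-- Arithmetical formulas

standardInterp : (ℕ → ℕ → Bool) → Interp
standardInterp M less x y _ = does (x <? y)
standardInterp M seq  p x y = does (elem p x ≟ y)
standardInterp M mem  i x _ = M i x

module StandardInterp (M : ℕ → ℕ → Bool) where

  open Arithmetic {standardInterp M} (λ _ _ → refl)

  functional : ∀ {n} {ρ : Vec ℕ n} → ⟦ functionalSeq ⟧ᶠ (literal (standardInterp M)) ρ
  functional {ρ = ρ} p x y z with elem p x ≟ y | elem p x ≟ z
  ... | no  ¬y | _     = inj₁ (dec-false (elem p x ≟ y) ¬y)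
  ... | yes _ | no ¬z = inj₂ (inj₁ (dec-false (elem p x ≟ z) ¬z))
  ... | yes y | yes z = inj₂ (inj₂ (⇒eq (_ ∷ _ ∷ x ∷ p ∷ ρ) 1F 0F (trans (sym y) z)))

  graph-complete : ∀ {m n} (f : Rec m) {ρ : Vec ℕ n} {σ y vs v} →
                   (∀ i → lookup ρ (σ i) ≡ lookup vs i) → lookup ρ y ≡ v →
                   f [ vs ]⇓ v → ⟦ graph f σ y ⟧ᶠ (literal (standardInterp M)) ρ
  graph-complete = ⇓⇒graph λ w k → let p , _ , h = elem-surjective w k 0 in
    p , λ x x<k → dec-true (elem p x ≟ w x) (h x x<k)

-- The Boolean is the polarity, `false` pushing a negation down to the atoms. Atoms first guess the
-- values of their terms, and a set variable becomes its index as first argument of `mem`.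
formula : Bool → ∀ {k m n} → Arith k m → (Fin m → Fin n) → Fm n
formula true (t `≡ u) σ =
  ex (graph (termᴿ t) (suc ∘ σ) 0F ⋀ graph (termᴿ u) (suc ∘ σ) 0F)
formula false (t `≡ u) σ =
  ex (ex (graph (termᴿ t) (λ i → suc (suc (σ i))) 1F ⋀
          graph (termᴿ u) (λ i → suc (suc (σ i))) 0F ⋀ (lt 1F 0F ⋁ lt 0F 1F)))
formula b (t `∈ x) σ =
  ex (ex (graph (constᴿ (toℕ x)) (λ i → suc (suc (σ i))) 1F ⋀
          graph (termᴿ t) (λ i → suc (suc (σ i))) 0F ⋀ rel b mem 1F 0F 0F))
formula b     (`¬ φ)   σ = formula (not b) φ σ
formula true  (φ `∧ ψ) σ = formula true φ σ ⋀ formula true ψ σ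
formula false (φ `∧ ψ) σ = formula false φ σ ⋁ formula false ψ σ
formula true  (φ `∨ ψ) σ = formula true φ σ ⋁ formula true ψ σ
formula false (φ `∨ ψ) σ = formula false φ σ ⋀ formula false ψ σ
formula true  (`∀ φ)   σ = all (formula true φ (0F ∷ᶠ (suc ∘ σ)))
formula false (`∀ φ)   σ = ex (formula false φ (0F ∷ᶠ (suc ∘ σ)))
formula true  (`∃ φ)   σ = ex (formula true φ (0F ∷ᶠ (suc ∘ σ)))
formula false (`∃ φ)   σ = all (formula false φ (0F ∷ᶠ (suc ∘ σ)))

Signed : Bool → Set → Set
Signed true  A = A
Signed false A = ¬ A

module FormulaSound {I : Interp} (std : Standard I)
  (functional : ∀ {p x y z} → I seq p x y ≡ true → I seq p x z ≡ true → y ≡ z) where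

  open Arithmetic {I} std

  sets : ∀ {k} → Fin k → ℕ → Bool
  sets x a = I mem (toℕ x) a a

  graph-value : ∀ {m n} (f : Rec m) {ρ : Vec ℕ n} {σ y vs v} →
                (∀ i → lookup ρ (σ i) ≡ lookup vs i) → f [ vs ]⇓ v →
                ⟦ graph f σ y ⟧ᶠ (literal I) ρ → lookup ρ y ≡ v
  graph-value f e d h = ⇓-det f (graph⇒⇓ functional f e refl h) d

  -- Constructive, since a negation normal form implies the negation it stands for.
  formula-sound : ∀ b {k m n} (φ : Arith k m) {σ : Fin m → Fin n} {ρ ρ′} →
                  (∀ i → lookup ρ (σ i) ≡ lookup ρ′ i) →
                  ⟦ formula b φ σ ⟧ᶠ (literal I) ρ → Signed b (⟦ φ ⟧ᵃ sets ρ′)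
  formula-sound true (t `≡ u) {ρ′ = ρ′} e (z , p , q) =
    trans (sym (graph-value (termᴿ t) {vs = ρ′} e (termᴿ⇓ t ρ′) p))
          (graph-value (termᴿ u) {vs = ρ′} e (termᴿ⇓ u ρ′) q)
  formula-sound false (t `≡ u) {ρ′ = ρ′} e (z , w , p , q , r) t≡u =
    [ <-irrefl z≡w ∘ lt⇒< , <-irrefl (sym z≡w) ∘ lt⇒< ]′ r
    where
    z≡w : z ≡ w
    z≡w = trans (graph-value (termᴿ t) {vs = ρ′} e (termᴿ⇓ t ρ′) p)
                (trans t≡u (sym (graph-value (termᴿ u) {vs = ρ′} e (termᴿ⇓ u ρ′) q)))
  formula-sound true (t `∈ x) {ρ′ = ρ′} e (i , a , p , q , r)
    with refl ← graph-value (constᴿ (toℕ x)) {vs = ρ′} e (constᴿ⇓ (toℕ x)) p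
       | refl ← graph-value (termᴿ t) {vs = ρ′} e (termᴿ⇓ t ρ′) q = r
  formula-sound false (t `∈ x) {ρ′ = ρ′} e (i , a , p , q , r) member
    with refl ← graph-value (constᴿ (toℕ x)) {vs = ρ′} e (constᴿ⇓ (toℕ x)) p
       | refl ← graph-value (termᴿ t) {vs = ρ′} e (termᴿ⇓ t ρ′) q =
    contradiction (trans (sym member) r) λ ()
  formula-sound true  (`¬ φ)   e h        = formula-sound false φ e h
  formula-sound false (`¬ φ)   e h ¬φ     = ¬φ (formula-sound true φ e h)
  formula-sound true  (φ `∧ ψ) e (p , q)  = formula-sound true φ e p , formula-sound true ψ e q
  formula-sound false (φ `∧ ψ) e (inj₁ p) = formula-sound false φ e p ∘ proj₁
  formula-sound false (φ `∧ ψ) e (inj₂ q) = formula-sound false ψ e q ∘ proj₂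
  formula-sound true  (φ `∨ ψ) e (inj₁ p) = inj₁ (formula-sound true φ e p)
  formula-sound true  (φ `∨ ψ) e (inj₂ q) = inj₂ (formula-sound true ψ e q)
  formula-sound false (φ `∨ ψ) e (p , q)  = [ formula-sound false φ e p , formula-sound false ψ e q ]′
  formula-sound true  (`∀ φ) e h a        = formula-sound true φ (λ { zero → refl ; (suc i) → e i }) (h a)
  formula-sound false (`∀ φ) e (a , h) g  = formula-sound false φ (λ { zero → refl ; (suc i) → e i }) h (g a)
  formula-sound true  (`∃ φ) e (a , h)    = a , formula-sound true φ (λ { zero → refl ; (suc i) → e i }) h
  formula-sound false (`∃ φ) e h (a , g)  = formula-sound false φ (λ { zero → refl ; (suc i) → e i }) (h a) g

module FormulaComplete (em : ExcludedMiddle (lsuc 0ℓ)) {k} (Y : Fin k → ℕ → Bool) where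

  decide : (A : Set) → Dec A
  decide A with em {Lift _ A}
  ... | yes (lift a) = yes a
  ... | no ¬a        = no (¬a ∘ lift)

  -- Numbers from `k` on name no set variable and get the empty set by default.
  members : ℕ → ℕ → Bool
  members i a with i <? k
  ... | yes i<k = Y (fromℕ< i<k) a
  ... | no  _   = false

  members-toℕ : ∀ x a → members (toℕ x) a ≡ Y x a
  members-toℕ x a with toℕ x <? k
  ... | yes i<k = cong (λ y → Y y a) (fromℕ<-toℕ x i<k)
  ... | no  i≮k = contradiction (toℕ<n x) i≮k

  open Arithmetic {standardInterp members} (λ _ _ → refl)
  open StandardInterp members

  -- Excluded middle enters for double negations, negated conjunctions and negated universal
  -- quantifiers.
  formula-complete : ∀ b {m n} (φ : Arith k m) {σ : Fin m → Fin n} {ρ ρ′} →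
                     (∀ i → lookup ρ (σ i) ≡ lookup ρ′ i) → Signed b (⟦ φ ⟧ᵃ Y ρ′) →
                     ⟦ formula b φ σ ⟧ᶠ (literal (standardInterp members)) ρ
  formula-complete true (t `≡ u) {ρ′ = ρ′} e t≡u =
    ⟦ t ⟧ᵗ ρ′ , graph-complete (termᴿ t) {vs = ρ′} e refl (termᴿ⇓ t ρ′) ,
    graph-complete (termᴿ u) {vs = ρ′} e t≡u (termᴿ⇓ u ρ′)
  formula-complete false (t `≡ u) {ρ′ = ρ′} e t≢u =
    ⟦ t ⟧ᵗ ρ′ , ⟦ u ⟧ᵗ ρ′ , graph-complete (termᴿ t) {vs = ρ′} e refl (termᴿ⇓ t ρ′) ,
    graph-complete (termᴿ u) {vs = ρ′} e refl (termᴿ⇓ u ρ′) ,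
    [ inj₁ ∘ <⇒lt , inj₂ ∘ <⇒lt ]′ (≢⇒<∨> t≢u)
    where
    ≢⇒<∨> : ∀ {x y} → x ≢ y → x < y ⊎ y < x
    ≢⇒<∨> {x} {y} x≢y with <-cmp x y
    ... | tri< x<y _ _ = inj₁ x<y
    ... | tri≈ _ x≡y _ = contradiction x≡y x≢y
    ... | tri> _ _ y<x = inj₂ y<x
  formula-complete true (t `∈ x) {ρ′ = ρ′} e h =
    toℕ x , ⟦ t ⟧ᵗ ρ′ , graph-complete (constᴿ (toℕ x)) {vs = ρ′} e refl (constᴿ⇓ (toℕ x)) ,
    graph-complete (termᴿ t) {vs = ρ′} e refl (termᴿ⇓ t ρ′) , trans (members-toℕ x _) h
  formula-complete false (t `∈ x) {ρ′ = ρ′} e h =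
    toℕ x , ⟦ t ⟧ᵗ ρ′ , graph-complete (constᴿ (toℕ x)) {vs = ρ′} e refl (constᴿ⇓ (toℕ x)) ,
    graph-complete (termᴿ t) {vs = ρ′} e refl (termᴿ⇓ t ρ′) ,
    trans (members-toℕ x _) (¬-not h)
  formula-complete true  (`¬ φ) e h = formula-complete false φ e h
  formula-complete false (`¬ φ) e h = formula-complete true φ e (decidable-stable (decide _) h)
  formula-complete true  (φ `∧ ψ) e (p , q) = formula-complete true φ e p , formula-complete true ψ e q
  formula-complete false (φ `∧ ψ) {ρ′ = ρ′} e h with decide (⟦ φ ⟧ᵃ Y ρ′)
  ... | yes p = inj₂ (formula-complete false ψ e λ q → h (p , q))
  ... | no ¬p = inj₁ (formula-complete false φ e ¬p)
  formula-complete true  (φ `∨ ψ) e (inj₁ p) = inj₁ (formula-complete true φ e p)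
  formula-complete true  (φ `∨ ψ) e (inj₂ q) = inj₂ (formula-complete true ψ e q)
  formula-complete false (φ `∨ ψ) e h =
    formula-complete false φ e (h ∘ inj₁) , formula-complete false ψ e (h ∘ inj₂)
  formula-complete true  (`∀ φ) e h a = formula-complete true φ (λ { zero → refl ; (suc i) → e i }) (h a)
  formula-complete false (`∀ φ) {ρ′ = ρ′} e h with decide (∃[ a ] ¬ ⟦ φ ⟧ᵃ Y (a ∷ ρ′))
  ... | yes (a , ¬p) = a , formula-complete false φ (λ { zero → refl ; (suc i) → e i }) ¬p
  ... | no  none     = contradiction (λ a → decidable-stable (decide _) λ ¬p → none (a , ¬p)) h
  formula-complete true  (`∃ φ) e (a , h) =
    a , formula-complete true φ (λ { zero → refl ; (suc i) → e i }) h
  formula-complete false (`∃ φ) e h a =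
    formula-complete false φ (λ { zero → refl ; (suc i) → e i }) λ p → h (a , p)

-- Membership in the two classes as first-order formulas, and hardness

noVars : ∀ {n} → Fin 0 → Fin n
noVars ()

outputsOne : Rec 2 → Fm 1
outputsOne c = functionalSeq ⋀
  ex (ex (graph (constᴿ 1) noVars 0F ⋀ graph c (2F ∷ᶠ 1F ∷ᶠ noVars) 0F))

-- From any standard interpretation with functional `seq` a computation is recovered; conversely,
-- `elem` supplies the codes that the graph formulas ask for.
outputsOne-correct : ∀ c n →
  (Σ[ I ∈ Interp ] Standard I × ⟦ outputsOne c ⟧ᶠ (literal I) (n ∷ [])) ⇔
  (∃[ m ] c [ n ∷ m ∷ [] ]⇓ 1)
outputsOne-correct c n = mk⇔ to from
  where
  to : (Σ[ I ∈ Interp ] Standard I × ⟦ outputsOne c ⟧ᶠ (literal I) (n ∷ [])) →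
       ∃[ m ] c [ n ∷ m ∷ [] ]⇓ 1
  to (I , std , fun , m , o , one , h) =
    m , graph⇒⇓ functional c {ρ} {2F ∷ᶠ 1F ∷ᶠ noVars} {0F} (λ { 0F → refl ; 1F → refl })
          (⇓-det (constᴿ 1) (graph⇒⇓ functional (constᴿ 1) {ρ} {noVars} {0F} {[]} (λ ()) refl one)
                             (constᴿ⇓ 1)) h
    where
    open Arithmetic {I} std
    ρ : Vec ℕ 3
    ρ = o ∷ m ∷ n ∷ []
    functional : ∀ {p x y z} → I seq p x y ≡ true → I seq p x z ≡ true → y ≡ z
    functional = functionalSeq⇒ {ρ = n ∷ []} fun
  from : (∃[ m ] c [ n ∷ m ∷ [] ]⇓ 1) →
         Σ[ I ∈ Interp ] Standard I × ⟦ outputsOne c ⟧ᶠ (literal I) (n ∷ [])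
  from (m , d) =
    standardInterp (λ _ _ → false) , (λ _ _ → refl) , functional {ρ = n ∷ []} , m , 1 ,
    graph-complete (constᴿ 1) {ρ} {noVars} {0F} {[]} (λ ()) refl (constᴿ⇓ 1) ,
    graph-complete c {ρ} {2F ∷ᶠ 1F ∷ᶠ noVars} {0F} (λ { 0F → refl ; 1F → refl }) refl d
    where
    open StandardInterp (λ _ _ → false)
    ρ : Vec ℕ 3
    ρ = 1 ∷ m ∷ n ∷ []

arithmetical : ∀ {k} → Arith k 1 → Fm 1
arithmetical ψ = functionalSeq ⋀ formula true ψ id

arithmetical-correct : ExcludedMiddle (lsuc 0ℓ) → ∀ {k} (ψ : Arith k 1) n →
  (Σ[ I ∈ Interp ] Standard I × ⟦ arithmetical ψ ⟧ᶠ (literal I) (n ∷ [])) ⇔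
  (Σ[ Y ∈ (Fin k → ℕ → Bool) ] ⟦ ψ ⟧ᵃ Y (n ∷ []))
arithmetical-correct em {k} ψ n = mk⇔ to from
  where
  to : (Σ[ I ∈ Interp ] Standard I × ⟦ arithmetical ψ ⟧ᶠ (literal I) (n ∷ [])) →
       Σ[ Y ∈ (Fin k → ℕ → Bool) ] ⟦ ψ ⟧ᵃ Y (n ∷ [])
  to (I , std , fun , h) = sets , formula-sound true ψ (λ _ → refl) h
    where
    open Arithmetic {I} std
    functional : ∀ {p x y z} → I seq p x y ≡ true → I seq p x z ≡ true → y ≡ z
    functional = functionalSeq⇒ {ρ = n ∷ []} fun
    open FormulaSound {I} std functional
  from : (Σ[ Y ∈ (Fin k → ℕ → Bool) ] ⟦ ψ ⟧ᵃ Y (n ∷ [])) →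
         Σ[ I ∈ Interp ] Standard I × ⟦ arithmetical ψ ⟧ᶠ (literal I) (n ∷ [])
  from (Y , h) =
    standardInterp members , (λ _ _ → refl) ,
    StandardInterp.functional members {ρ = n ∷ []} , formula-complete true ψ (λ _ → refl) h
    where open FormulaComplete em Y

outputs-one : ∀ {c : Rec 2} {n m} b → c [ n ∷ m ∷ [] ]⇓ (if b then 1 else 0) →
              c [ n ∷ m ∷ [] ]⇓ 1 ⇔ b ≡ true
outputs-one true  d = mk⇔ (λ _ → refl) (λ _ → d)
outputs-one {c} false d = mk⇔ (λ e → contradiction (⇓-det c e d) λ ()) λ ()

corollary4 : Hard ⌜_⌝ Σ⁰₁ (SAT ⊆,∨ᴮ) ×
    (ExcludedMiddle (lsuc 0ℓ) → Hard ⌜_⌝ Σ¹₁ (SAT ⊆,∨ᴮ,𝖠))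
corollary4 = semidecidable , analytic
  where
  semidecidable : Hard ⌜_⌝ Σ⁰₁ (SAT ⊆,∨ᴮ)
  semidecidable A (R , (c , c⇓) , A⇔) =
    reduction (outputsOne c) ,
    code-∧X^ (reduction (outputsOne c))
      setup (body (outputsOne c)) (λ _ → refl) , correct
    where
    open Translation ⊆,∨ᴮ
    outputs : ∀ n → (∃[ m ] R n m ≡ true) ⇔ (∃[ m ] c [ n ∷ m ∷ [] ]⇓ 1)
    outputs n = mk⇔
      (λ (m , r) → m , Equivalence.from (outputs-one (R n m) (c⇓ (n ∷ m ∷ []))) r)
      (λ (m , d) → m , Equivalence.to (outputs-one (R n m) (c⇓ (n ∷ m ∷ []))) d)
    correct : ∀ n → A n ⇔ SAT ⊆,∨ᴮ (reduction (outputsOne c) n)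
    correct n = ⇔-sym (outputsOne-correct c n ⇔-∘ reduction-correct (outputsOne c) n)
                ⇔-∘ (outputs n ⇔-∘ A⇔ n)
  analytic : ExcludedMiddle (lsuc 0ℓ) → Hard ⌜_⌝ Σ¹₁ (SAT ⊆,∨ᴮ,𝖠)
  analytic em A (k , ψ , A⇔) =
    reduction (arithmetical ψ) ,
    code-∧X^ (reduction (arithmetical ψ))
      setup (body (arithmetical ψ)) (λ _ → refl) , λ n →
    ⇔-sym (arithmetical-correct em ψ n ⇔-∘ reduction-correct (arithmetical ψ) n) ⇔-∘ A⇔ n
    where open Translation ⊆,∨ᴮ,𝖠
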